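{- Let $G=(V,E)$ be a strongly regular graph with vertex degree $d$ (and parameter $\beta\ge1$). (i) If $G$ has girth $4$, then for any $x\in V$, $$\mathcal K_{G,x}(\mathcal N)=2-\frac{2d}{\mathcal N}\qquad\text{for all }\mathcal N\in(0,\infty].$$ (ii) If $G$ has girth $5$, then for any $x\in V$, $$\mathcal K_{G,x}(\mathcal N)=\begin{cases}2-\frac{2d}{\mathcal N},&\text{if }0<\mathcal N\le2,\\[1mm]2-d,&\text{if }\mathcal N>2.\end{cases}$$
   Context: For a locally finite simple graph $G=(V,E)$ and $f:V\to\mathbb R$ put $\Delta f(x)=\sum_{y\sim x}(f(y)-f(x))$ (non-normalized Laplacian), and for $f,g:V\to\mathbb R$ put $2\Gamma(f,g)=\Delta(fg)-f\Delta g-g\Delta f$, $2\Gamma_2(f,g)=\Delta\Gamma(f,g)-\Gamma(f,\Delta g)-\Gamma(\Delta f,g)$, $\Gamma(f)=\Gamma(f,f)$, $\Gamma_2(f)=\Gamma_2(f,f)$. For $\mathcal N\in(0,\infty]$ (convention $1/\infty=0$), $\mathcal K_{G,x}(\mathcal N)$ is the largest $K\in\mathbb R$ such that $\Gamma_2(f)(x)\ge\frac1{\mathcal N}(\Delta f(x))^2+K\,\Gamma(f)(x)$ for all $f:V\to\mathbb R$ (Bakry-Émery curvature function). A finite simple $d$-regular graph with $N$ vertices is strongly regular with parameters $(N,d,\alpha,\beta)$ if every two adjacent vertices have exactly $\alpha$ common neighbours and every two distinct non-adjacent vertices have exactly $\beta$ common neighbours. Complete graphs and disjoint unions of copies of a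 complete graph are regarded as the case $\beta=0$ and are excluded. The girth is the length of a shortest cycle. -}

module Defs where

open import Data.Empty using (⊥)
open import Data.Fin.Base as Fin using (Fin; inject₁)
open import Data.Integer.Base using (+_)
open import Data.List.Base using (List; allFin; filter; foldr; length; map)
open import Data.Nat.Base as ℕ using (ℕ; zero; suc)
import Data.Nat.Properties as ℕ
open import Data.Product.Base using (∃; ∃-syntax; _×_; _,_)
open import Data.Rational.Base as ℚ using (ℚ; 0ℚ; 1ℚ; ½; 1/_; ∣_∣; Positive; NonZero)
import Data.Rational.Properties as ℚ
open import Data.Rational.Solver using (module +-*-Solver)
open import Data.Unit.Base using (⊤)
open import Function.Definitions using (Injective)
open import Relation.Binary.Core using (Rel)
open import Relation.Binary.Definitions using (Decidable; Irreflexive; Symmetric)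
open import Relation.Binary.PropositionalEquality
open import Relation.Nullary.Decidable using (_×-dec_)
open import Relation.Nullary.Negation using (¬_)
open import Level using (0ℓ)

------------------------------------------------------------------------
-- Real numbers: Cauchy sequences of rationals, with pointwise arithmetic.
-- Two sequences denote the same real iff each is _≤_ the other.

IsCauchy : (ℕ → ℚ) → Set
IsCauchy s = ∀ ε → 0ℚ ℚ.< ε →
  ∃[ M ] ∀ m n → M ℕ.≤ m → M ℕ.≤ n → ∣ s m ℚ.- s n ∣ ℚ.≤ ε

record ℝ : Set where
  constructor mkℝ
  field
    seq    : ℕ → ℚ
    cauchy : IsCauchy seq

open ℝ public

cauchy-scaled : ∀ s C → .{{Positive C}} →
  (∀ ε → 0ℚ ℚ.< ε →
    ∃[ M ] ∀ m n → M ℕ.≤ m → M ℕ.≤ n → ∣ s m ℚ.- s n ∣ ℚ.≤ C ℚ.* ε) →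
  IsCauchy s
cauchy-scaled s C h ε 0<ε =
  let M , close = h (C⁻¹ ℚ.* ε) 0<C⁻¹ε
  in M , λ m n M≤m M≤n → ℚ.≤-trans (close m n M≤m M≤n) (ℚ.≤-reflexive C*C⁻¹ε)
  where
  instance
    C≢0 : NonZero C
    C≢0 = ℚ.pos⇒nonZero C
  C⁻¹ : ℚ
  C⁻¹ = 1/ C
  0<C⁻¹ε : 0ℚ ℚ.< C⁻¹ ℚ.* ε
  0<C⁻¹ε = ℚ.positive⁻¹ (C⁻¹ ℚ.* ε)
    {{ℚ.pos*pos⇒pos C⁻¹ {{ℚ.1/pos⇒pos C}} ε {{ℚ.positive 0<ε}}}}
  C*C⁻¹ε : C ℚ.* (C⁻¹ ℚ.* ε) ≡ ε
  C*C⁻¹ε = begin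
    C ℚ.* (C⁻¹ ℚ.* ε)  ≡⟨ ℚ.*-assoc C C⁻¹ ε ⟨
    C ℚ.* C⁻¹ ℚ.* ε    ≡⟨ cong (ℚ._* ε) (ℚ.*-inverseʳ C) ⟩
    1ℚ ℚ.* ε           ≡⟨ ℚ.*-identityˡ ε ⟩
    ε                  ∎
    where open ≡-Reasoning

eventually-bounded : ∀ x →
  ∃[ B ] Positive B × ∃[ M ] ∀ n → M ℕ.≤ n → ∣ seq x n ∣ ℚ.≤ B
eventually-bounded (mkℝ s c) =
  let M , close = c 1ℚ (ℚ.positive⁻¹ 1ℚ)
  in 1ℚ ℚ.+ ∣ s M ∣
   , ℚ.pos+nonNeg⇒pos 1ℚ ∣ s M ∣ {{ℚ.∣-∣-nonNeg (s M)}}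
   , M
   , λ n M≤n → begin
       ∣ s n ∣                    ≡⟨ cong ∣_∣ (split (s n) (s M)) ⟩
       ∣ (s n ℚ.- s M) ℚ.+ s M ∣  ≤⟨ ℚ.∣p+q∣≤∣p∣+∣q∣ (s n ℚ.- s M) (s M) ⟩
       ∣ s n ℚ.- s M ∣ ℚ.+ ∣ s M ∣
         ≤⟨ ℚ.+-monoˡ-≤ ∣ s M ∣ (close n M M≤n ℕ.≤-refl) ⟩
       1ℚ ℚ.+ ∣ s M ∣             ∎
  where
  open ℚ.≤-Reasoning
  split : ∀ a b → a ≡ (a ℚ.- b) ℚ.+ b
  split = solve 2 (λ a b → a := (a :- b) :+ b) refl
    where open +-*-Solver

fromℚ : ℚ → ℝ
fromℚ q = mkℝ (λ _ → q) λ ε 0<ε → 0 , λ _ _ _ _ →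
  ℚ.≤-trans (ℚ.≤-reflexive (cong ∣_∣ (ℚ.+-inverseʳ q))) (ℚ.<⇒≤ 0<ε)

fromℕ : ℕ → ℝ
fromℕ k = fromℚ (+ k ℚ./ 1)

0ℝ : ℝ
0ℝ = fromℚ 0ℚ

infix  8 -_
infixl 7 _*_
infixl 6 _+_ _-_
infix  4 _≤_ _<_

_+_ : ℝ → ℝ → ℝ
mkℝ s c + mkℝ t d = mkℝ s+t (cauchy-scaled s+t (1ℚ ℚ.+ 1ℚ) sum-close)
  where
  s+t : ℕ → ℚ
  s+t n = s n ℚ.+ t n
  open ℚ.≤-Reasoning
  regroup : ∀ a b a′ b′ →
    (a ℚ.+ b) ℚ.- (a′ ℚ.+ b′) ≡ (a ℚ.- a′) ℚ.+ (b ℚ.- b′)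
  regroup = solve 4 (λ a b a′ b′ →
    (a :+ b) :- (a′ :+ b′) := (a :- a′) :+ (b :- b′)) refl
    where open +-*-Solver
  double : ∀ e → e ℚ.+ e ≡ (1ℚ ℚ.+ 1ℚ) ℚ.* e
  double = solve 1 (λ e → e :+ e := (con 1ℚ :+ con 1ℚ) :* e) refl
    where open +-*-Solver
  sum-close : ∀ ε → 0ℚ ℚ.< ε → ∃[ M ] ∀ m n → M ℕ.≤ m → M ℕ.≤ n →
    ∣ (s m ℚ.+ t m) ℚ.- (s n ℚ.+ t n) ∣ ℚ.≤ (1ℚ ℚ.+ 1ℚ) ℚ.* ε
  sum-close ε 0<ε =
    let M₁ , s-close = c ε 0<ε
        M₂ , t-close = d ε 0<ε
    in M₁ ℕ.⊔ M₂ , λ m n M≤m M≤n → begin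
      ∣ (s m ℚ.+ t m) ℚ.- (s n ℚ.+ t n) ∣
        ≡⟨ cong ∣_∣ (regroup (s m) (t m) (s n) (t n)) ⟩
      ∣ (s m ℚ.- s n) ℚ.+ (t m ℚ.- t n) ∣
        ≤⟨ ℚ.∣p+q∣≤∣p∣+∣q∣ (s m ℚ.- s n) (t m ℚ.- t n) ⟩
      ∣ s m ℚ.- s n ∣ ℚ.+ ∣ t m ℚ.- t n ∣
        ≤⟨ ℚ.+-mono-≤
             (s-close m n (ℕ.m⊔n≤o⇒m≤o M₁ M₂ M≤m) (ℕ.m⊔n≤o⇒m≤o M₁ M₂ M≤n))
             (t-close m n (ℕ.m⊔n≤o⇒n≤o M₁ M₂ M≤m) (ℕ.m⊔n≤o⇒n≤o M₁ M₂ M≤n)) ⟩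
      ε ℚ.+ ε
        ≡⟨ double ε ⟩
      (1ℚ ℚ.+ 1ℚ) ℚ.* ε ∎

-_ : ℝ → ℝ
- mkℝ s c = mkℝ (λ n → ℚ.- s n) λ ε 0<ε →
  let M , close = c ε 0<ε
  in M , λ m n M≤m M≤n →
    ℚ.≤-trans (ℚ.≤-reflexive (dist-neg (s m) (s n))) (close m n M≤m M≤n)
  where
  dist-neg : ∀ a b → ∣ (ℚ.- a) ℚ.- (ℚ.- b) ∣ ≡ ∣ a ℚ.- b ∣
  dist-neg a b = trans
    (cong ∣_∣ (sym (ℚ.neg-distrib-+ a (ℚ.- b))))
    (ℚ.∣-p∣≡∣p∣ (a ℚ.- b))

_-_ : ℝ → ℝ → ℝ
x - y = x + (- y)

_*_ : ℝ → ℝ → ℝ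
x@(mkℝ s c) * y@(mkℝ t d) =
  let A , A>0 , M₁ , ∣s∣≤A = eventually-bounded x
      B , B>0 , M₂ , ∣t∣≤B = eventually-bounded y
  in mkℝ s*t
         (cauchy-scaled s*t (A ℚ.+ B) {{ℚ.pos+pos⇒pos A {{A>0}} B {{B>0}}}}
           (product-close A B M₁ M₂ {{A>0}} {{B>0}} ∣s∣≤A ∣t∣≤B))
  where
  s*t : ℕ → ℚ
  s*t n = s n ℚ.* t n
  open ℚ.≤-Reasoning
  regroup : ∀ a b a′ b′ →
    a ℚ.* b ℚ.- a′ ℚ.* b′ ≡ a ℚ.* (b ℚ.- b′) ℚ.+ b′ ℚ.* (a ℚ.- a′)
  regroup = solve 4 (λ a b a′ b′ →
    a :* b :- a′ :* b′ := a :* (b :- b′) :+ b′ :* (a :- a′)) refl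
    where open +-*-Solver
  ∣p*q∣-bound : ∀ {A ε} p q → .{{Positive A}} →
    ∣ p ∣ ℚ.≤ A → ∣ q ∣ ℚ.≤ ε → ∣ p ℚ.* q ∣ ℚ.≤ A ℚ.* ε
  ∣p*q∣-bound {A} {ε} p q ∣p∣≤A ∣q∣≤ε = begin
    ∣ p ℚ.* q ∣      ≡⟨ ℚ.∣p*q∣≡∣p∣*∣q∣ p q ⟩
    ∣ p ∣ ℚ.* ∣ q ∣  ≤⟨ ℚ.*-monoʳ-≤-nonNeg ∣ q ∣ {{ℚ.∣-∣-nonNeg q}} ∣p∣≤A ⟩
    A ℚ.* ∣ q ∣      ≤⟨ ℚ.*-monoˡ-≤-nonNeg A {{ℚ.pos⇒nonNeg A}} ∣q∣≤ε ⟩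
    A ℚ.* ε          ∎
  product-close : ∀ A B M₁ M₂ → .{{Positive A}} → .{{Positive B}} →
    (∀ n → M₁ ℕ.≤ n → ∣ s n ∣ ℚ.≤ A) → (∀ n → M₂ ℕ.≤ n → ∣ t n ∣ ℚ.≤ B) →
    ∀ ε → 0ℚ ℚ.< ε → ∃[ M ] ∀ m n → M ℕ.≤ m → M ℕ.≤ n →
    ∣ s m ℚ.* t m ℚ.- s n ℚ.* t n ∣ ℚ.≤ (A ℚ.+ B) ℚ.* ε
  product-close A B M₁ M₂ ∣s∣≤A ∣t∣≤B ε 0<ε =
    let M₃ , s-close = c ε 0<ε
        M₄ , t-close = d ε 0<ε
        M₁₂ = M₁ ℕ.⊔ M₂
        M₃₄ = M₃ ℕ.⊔ M₄
        ≥M₁ = λ {k} (p : M₁₂ ℕ.⊔ M₃₄ ℕ.≤ k) →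
                ℕ.m⊔n≤o⇒m≤o M₁ M₂ (ℕ.m⊔n≤o⇒m≤o M₁₂ M₃₄ p)
        ≥M₂ = λ {k} (p : M₁₂ ℕ.⊔ M₃₄ ℕ.≤ k) →
                ℕ.m⊔n≤o⇒n≤o M₁ M₂ (ℕ.m⊔n≤o⇒m≤o M₁₂ M₃₄ p)
        ≥M₃ = λ {k} (p : M₁₂ ℕ.⊔ M₃₄ ℕ.≤ k) →
                ℕ.m⊔n≤o⇒m≤o M₃ M₄ (ℕ.m⊔n≤o⇒n≤o M₁₂ M₃₄ p)
        ≥M₄ = λ {k} (p : M₁₂ ℕ.⊔ M₃₄ ℕ.≤ k) →
                ℕ.m⊔n≤o⇒n≤o M₃ M₄ (ℕ.m⊔n≤o⇒n≤o M₁₂ M₃₄ p)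
    in M₁₂ ℕ.⊔ M₃₄ , λ m n M≤m M≤n → begin
      ∣ s m ℚ.* t m ℚ.- s n ℚ.* t n ∣
        ≡⟨ cong ∣_∣ (regroup (s m) (t m) (s n) (t n)) ⟩
      ∣ s m ℚ.* (t m ℚ.- t n) ℚ.+ t n ℚ.* (s m ℚ.- s n) ∣
        ≤⟨ ℚ.∣p+q∣≤∣p∣+∣q∣ (s m ℚ.* (t m ℚ.- t n)) (t n ℚ.* (s m ℚ.- s n)) ⟩
      ∣ s m ℚ.* (t m ℚ.- t n) ∣ ℚ.+ ∣ t n ℚ.* (s m ℚ.- s n) ∣
        ≤⟨ ℚ.+-mono-≤
             (∣p*q∣-bound (s m) (t m ℚ.- t n)
               (∣s∣≤A m (≥M₁ M≤m)) (t-close m n (≥M₄ M≤m) (≥M₄ M≤n)))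
             (∣p*q∣-bound (t n) (s m ℚ.- s n)
               (∣t∣≤B n (≥M₂ M≤n)) (s-close m n (≥M₃ M≤m) (≥M₃ M≤n))) ⟩
      A ℚ.* ε ℚ.+ B ℚ.* ε
        ≡⟨ ℚ.*-distribʳ-+ ε A B ⟨
      (A ℚ.+ B) ℚ.* ε ∎

_≤_ : Rel ℝ 0ℓ
x ≤ y = ∀ ε → 0ℚ ℚ.< ε → ∃[ M ] ∀ n → M ℕ.≤ n → seq x n ℚ.≤ seq y n ℚ.+ ε

_<_ : Rel ℝ 0ℓ
x < y = ∃[ ε ] 0ℚ ℚ.< ε × ∃[ M ] ∀ n → M ℕ.≤ n → seq x n ℚ.+ ε ℚ.≤ seq y n

-- The first M terms, which may vanish, are dropped before inverting
-- pointwise; this leaves the real number unchanged.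
inverse : (x : ℝ) → 0ℝ < x → ℝ
inverse (mkℝ s c) (e , 0<e , M , e≤s) = mkℝ s⁻¹ (cauchy-scaled s⁻¹ (E ℚ.* E) inverse-close)
  where
  open ℚ.≤-Reasoning
  u : ℕ → ℚ
  u n = s (M ℕ.+ n)
  instance
    e>0 : Positive e
    e>0 = ℚ.positive 0<e
    e≢0 : NonZero e
    e≢0 = ℚ.pos⇒nonZero e
  e≤u : ∀ n → e ℚ.≤ u n
  e≤u n = ℚ.≤-trans (ℚ.≤-reflexive (sym (ℚ.+-identityˡ e)))
                    (e≤s (M ℕ.+ n) (ℕ.m≤m+n M n))
  u>0 : ∀ n → Positive (u n)
  u>0 n = ℚ.positive (ℚ.<-≤-trans 0<e (e≤u n))
  u≢0 : ∀ n → NonZero (u n)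
  u≢0 n = ℚ.pos⇒nonZero (u n) {{u>0 n}}
  s⁻¹ : ℕ → ℚ
  s⁻¹ n = (1/ u n) {{u≢0 n}}
  s⁻¹>0 : ∀ n → Positive (s⁻¹ n)
  s⁻¹>0 n = ℚ.1/pos⇒pos (u n) {{u>0 n}}
  E : ℚ
  E = 1/ e
  instance
    E>0 : Positive E
    E>0 = ℚ.1/pos⇒pos e
    E*E>0 : Positive (E ℚ.* E)
    E*E>0 = ℚ.pos*pos⇒pos E E
  u*s⁻¹ : ∀ n → u n ℚ.* s⁻¹ n ≡ 1ℚ
  u*s⁻¹ n = ℚ.*-inverseʳ (u n) {{u≢0 n}}
  s⁻¹≤E : ∀ n → s⁻¹ n ℚ.≤ E
  s⁻¹≤E n = begin
    s⁻¹ n                    ≡⟨ ℚ.*-identityˡ (s⁻¹ n) ⟨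
    1ℚ ℚ.* s⁻¹ n             ≡⟨ cong (ℚ._* s⁻¹ n) (ℚ.*-inverseˡ e) ⟨
    E ℚ.* e ℚ.* s⁻¹ n
      ≤⟨ ℚ.*-monoʳ-≤-nonNeg (s⁻¹ n) {{ℚ.pos⇒nonNeg (s⁻¹ n) {{s⁻¹>0 n}}}}
           (ℚ.*-monoˡ-≤-nonNeg E {{ℚ.pos⇒nonNeg E}} (e≤u n)) ⟩
    E ℚ.* u n ℚ.* s⁻¹ n      ≡⟨ ℚ.*-assoc E (u n) (s⁻¹ n) ⟩
    E ℚ.* (u n ℚ.* s⁻¹ n)    ≡⟨ cong (E ℚ.*_) (u*s⁻¹ n) ⟩
    E ℚ.* 1ℚ                 ≡⟨ ℚ.*-identityʳ E ⟩
    E                        ∎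
  difference : ∀ a b a′ b′ → a ℚ.* a′ ≡ 1ℚ → b ℚ.* b′ ≡ 1ℚ →
    a′ ℚ.- b′ ≡ (a′ ℚ.* b′) ℚ.* (b ℚ.- a)
  difference a b a′ b′ aa′ bb′ = begin-equality
    a′ ℚ.- b′
      ≡⟨ cong₂ ℚ._-_ (ℚ.*-identityʳ a′) (ℚ.*-identityʳ b′) ⟨
    a′ ℚ.* 1ℚ ℚ.- b′ ℚ.* 1ℚ
      ≡⟨ cong₂ (λ p q → a′ ℚ.* p ℚ.- b′ ℚ.* q) bb′ aa′ ⟨
    a′ ℚ.* (b ℚ.* b′) ℚ.- b′ ℚ.* (a ℚ.* a′)
      ≡⟨ solve 4 (λ a b a′ b′ → a′ :* (b :* b′) :- b′ :* (a :* a′)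
                             := (a′ :* b′) :* (b :- a)) refl a b a′ b′ ⟩
    (a′ ℚ.* b′) ℚ.* (b ℚ.- a) ∎
    where open +-*-Solver
  inverse-close : ∀ ε → 0ℚ ℚ.< ε → ∃[ K ] ∀ m n → K ℕ.≤ m → K ℕ.≤ n →
    ∣ s⁻¹ m ℚ.- s⁻¹ n ∣ ℚ.≤ (E ℚ.* E) ℚ.* ε
  inverse-close ε 0<ε =
    let K , close = c ε 0<ε
    in K , λ m n K≤m K≤n →
      let P = s⁻¹ m ℚ.* s⁻¹ n
          instance
            P≥0 = ℚ.pos⇒nonNeg P
              {{ℚ.pos*pos⇒pos (s⁻¹ m) {{s⁻¹>0 m}} (s⁻¹ n) {{s⁻¹>0 n}}}}
      in begin
        ∣ s⁻¹ m ℚ.- s⁻¹ n ∣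
          ≡⟨ cong ∣_∣ (difference (u m) (u n) (s⁻¹ m) (s⁻¹ n) (u*s⁻¹ m) (u*s⁻¹ n)) ⟩
        ∣ P ℚ.* (u n ℚ.- u m) ∣
          ≡⟨ ℚ.∣p*q∣≡∣p∣*∣q∣ P (u n ℚ.- u m) ⟩
        ∣ P ∣ ℚ.* ∣ u n ℚ.- u m ∣
          ≡⟨ cong (ℚ._* ∣ u n ℚ.- u m ∣) (ℚ.0≤p⇒∣p∣≡p (ℚ.nonNegative⁻¹ P)) ⟩
        P ℚ.* ∣ u n ℚ.- u m ∣
          ≤⟨ ℚ.*-monoˡ-≤-nonNeg P
               (close (M ℕ.+ n) (M ℕ.+ m)
                 (ℕ.≤-trans K≤n (ℕ.m≤n+m n M)) (ℕ.≤-trans K≤m (ℕ.m≤n+m m M))) ⟩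
        P ℚ.* ε
          ≤⟨ ℚ.*-monoʳ-≤-nonNeg ε {{ℚ.nonNegative (ℚ.<⇒≤ 0<ε)}}
               (ℚ.≤-trans
                 (ℚ.*-monoʳ-≤-nonNeg (s⁻¹ n) {{ℚ.pos⇒nonNeg (s⁻¹ n) {{s⁻¹>0 n}}}} (s⁻¹≤E m))
                 (ℚ.*-monoˡ-≤-nonNeg E {{ℚ.pos⇒nonNeg E}} (s⁻¹≤E n))) ⟩
        (E ℚ.* E) ℚ.* ε ∎

------------------------------------------------------------------------
-- Graphs

record SimpleGraph (n : ℕ) : Set₁ where
  infix 4 _∼_ _∼?_
  field
    _∼_    : Rel (Fin n) 0ℓ
    _∼?_   : Decidable _∼_
    ∼-sym  : Symmetric _∼_
    irrefl : Irreflexive _≡_ _∼_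

module _ {n : ℕ} (G : SimpleGraph n) where
  open SimpleGraph G

  neighbours : Fin n → List (Fin n)
  neighbours x = filter (x ∼?_) (allFin n)

  commonNeighbours : Fin n → Fin n → List (Fin n)
  commonNeighbours x y = filter (λ z → (x ∼? z) ×-dec (y ∼? z)) (allFin n)

  Complete : Set
  Complete = ∀ x y → x ≢ y → x ∼ y

  -- With n vertices, the parameters are (n , d , α , β).  A non-complete
  -- disjoint union of copies of a complete graph has β = 0, so it is
  -- excluded by β≥1; for a complete graph `nonadjacent` is vacuous, and it
  -- has to be excluded separately.
  record StronglyRegular (d α β : ℕ) : Set where
    field
      regular     : ∀ x → length (neighbours x) ≡ d
      adjacent    : ∀ x y → x ∼ y → length (commonNeighbours x y) ≡ α
      nonadjacent : ∀ x y → x ≢ y → ¬ (x ∼ y) → length (commonNeighbours x y) ≡ β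
      notComplete : ¬ Complete
      β≥1         : 1 ℕ.≤ β

  HasCycle : ℕ → Set
  HasCycle zero    = ⊥
  HasCycle (suc k) = 3 ℕ.≤ suc k × ∃ λ (c : Fin (suc k) → Fin n) →
    Injective _≡_ _≡_ c ×
    (∀ i → c (inject₁ i) ∼ c (Fin.suc i)) ×
    c (Fin.fromℕ k) ∼ c Fin.zero

  Girth : ℕ → Set
  Girth g = HasCycle g × (∀ k → HasCycle k → g ℕ.≤ k)

------------------------------------------------------------------------
-- Bakry–Émery curvature

  Δ : (Fin n → ℝ) → (Fin n → ℝ)
  Δ f x = foldr _+_ 0ℝ (map (λ y → f y - f x) (neighbours x))

  Γ : (f g : Fin n → ℝ) → (Fin n → ℝ)
  Γ f g x = fromℚ ½ *
    (Δ (λ y → f y * g y) x - f x * Δ g x - g x * Δ f x)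

  Γ₂ : (f g : Fin n → ℝ) → (Fin n → ℝ)
  Γ₂ f g x = fromℚ ½ *
    (Δ (Γ f g) x - Γ f (Δ g) x - Γ (Δ f) g x)

data Dimension : Set where
  finite : (N : ℝ) → 0ℝ < N → Dimension
  ∞      : Dimension

recip : Dimension → ℝ
recip (finite N 0<N) = inverse N 0<N
recip ∞              = 0ℝ

infix 4 _≤ᴰ_ _<ᴰ_

_≤ᴰ_ : Dimension → ℝ → Set
finite N _ ≤ᴰ r = N ≤ r
∞          ≤ᴰ r = ⊥

_<ᴰ_ : ℝ → Dimension → Set
r <ᴰ finite N _ = r < N
r <ᴰ ∞          = ⊤

module _ {n : ℕ} (G : SimpleGraph n) (x : Fin n) (𝒩 : Dimension) where

  CurvatureDimension : ℝ → Set
  CurvatureDimension K = ∀ (f : Fin n → ℝ) →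
    recip 𝒩 * (Δ G f x * Δ G f x) + K * Γ G f f x ≤ Γ₂ G f f x

  -- `HasCurvature K` says that the curvature function of G at x takes the
  -- value K at 𝒩: K is the largest constant in the inequality.
  HasCurvature : ℝ → Set
  HasCurvature K =
    CurvatureDimension K × (∀ K′ → CurvatureDimension K′ → K′ ≤ K)

{-# OPTIONS --safe #-}

-- Put g = f − f(x), A = Δf(x), Q = Σ g(y)² over the neighbours y of x, and let s(z) be the
-- sum of g(y) over the common neighbours y of x and z.  Without triangles, Γ₂(f)(x) involves
-- g beyond the neighbours of x only at the vertices z at distance two, each having β common
-- neighbours with x.  Completing the square in each g(z), and evaluating Σ s(z)² by strong
-- regularity, gives
--     4β Γ₂(f)(x) = Σ_z (β g(z) − 2 s(z))² + 2(β − 2)(dQ − A²) + 4βQ,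
-- where 2Γ(f)(x) = Q and A² ≤ dQ by Cauchy–Schwarz.  Girth 4 forces β ≥ 2 and girth 5 forces
-- β = 1, and the lower bounds on the curvature are read off from this identity.  They are
-- attained by functions for which the squares vanish: those constant on the neighbours of x
-- have A² = dQ, and those supported on two neighbours with opposite values have A = 0.
--
-- The operations on reals act term by term on the sequences, so the inequalities need to be
-- proved only for rational-valued functions.

module Submission where

open import Algebra.Bundles using (CommutativeRing)
open import Data.Bool.Base using (if_then_else_)
open import Data.Empty using (⊥; ⊥-elim)
open import Data.Fin.Base as Fin using (Fin)
open import Data.Fin.Patterns using (0F; 1F; 2F)
import Data.Fin.Properties as Fin
import Data.Integer.Base as ℤ
import Data.Integer.Properties as ℤ
open import Data.List.Base as List using (List; []; _∷_; allFin; filter; length)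
open import Data.List.Membership.Propositional using (_∈_)
open import Data.List.Membership.Propositional.Properties using (∈-filter⁺; ∈-filter⁻; ∈-allFin)
open import Data.List.Relation.Unary.All using ([]; _∷_)
open import Data.List.Relation.Unary.AllPairs using ([]; _∷_)
open import Data.List.Relation.Unary.Any using (here; there)
open import Data.List.Relation.Unary.Unique.Propositional using (Unique)
import Data.List.Relation.Unary.Unique.Propositional.Properties as Unique
open import Data.Nat.Base as ℕ using (ℕ; zero; suc)
import Data.Nat.Properties as ℕ
open import Data.Product.Base using (∃-syntax; _×_; _,_; proj₁; proj₂)
open import Data.Rational.Base as ℚ using (ℚ; 0ℚ; 1ℚ; ½)
import Data.Rational.Properties as ℚ
open import Data.Rational.Solver using (module +-*-Solver)
import Data.Rational.Unnormalised.Base as ℚᵘ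
import Data.Rational.Unnormalised.Properties as ℚᵘ
open import Data.Sum.Base using (inj₁; inj₂)
open import Data.Vec.Base as Vec using ([]; _∷_)
open import Data.Vec.Relation.Unary.All using ([]; _∷_)
open import Data.Vec.Relation.Unary.AllPairs using ([]; _∷_)
import Data.Vec.Relation.Unary.Unique.Propositional.Properties as Vec
import Defs
open Defs using (SimpleGraph; StronglyRegular; module StronglyRegular; neighbours; commonNeighbours;
  HasCycle; Girth; ℝ; seq; Dimension; finite; ∞; recip; 0ℝ; inverse; fromℚ)
open import Function.Base using (id; _∘_; case_of_)
open import Level using (0ℓ)
open import Relation.Binary.PropositionalEquality
open import Relation.Nullary.Decidable using (Dec; does; yes; no; ¬?; _×-dec_)
open import Relation.Unary using (Pred; Decidable)

open import Algebra.Properties.Semiring.Sum (CommutativeRing.semiring ℚ.+-*-commutativeRing)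
  using (sum; sum-cong-≗; ∑-comm; *-distribˡ-sum)
open +-*-Solver using (solve; _:=_; _:+_; _:*_; _:-_; :-_; con)

-- Rational arithmetic and finite sums weighted by 0-1 indicators.

module Sums where
  open import Data.Rational.Base hiding (ℚ; 0ℚ; 1ℚ; ½)

  ι : ℕ → ℚ
  ι k = ℤ.+ k / 1

  2ℚ 4ℚ : ℚ
  2ℚ = ι 2
  4ℚ = ι 4

  -- The fraction `ℤ.+ k / 1` is reduced through a gcd and so is stuck for a variable `k`; among
  -- unnormalised rationals the equation is one between integers.
  ι-suc : ∀ k → ι (suc k) ≡ 1ℚ + ι k
  ι-suc k = ℚ.toℚᵘ-injective (begin
    toℚᵘ (ι (suc k))        ≈⟨ ℚ.toℚᵘ-fromℚᵘ (ℚᵘ.mkℚᵘ (ℤ.+ suc k) 0) ⟩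
    ℚᵘ.mkℚᵘ (ℤ.+ suc k) 0     ≈⟨ ℚᵘ.*≡* (cong (λ j → (ℤ.+ 1 ℤ.+ j) ℤ.* ℤ.+ 1) (sym (ℤ.*-identityʳ (ℤ.+ k)))) ⟩
    ℚᵘ.1ℚᵘ ℚᵘ.+ ℚᵘ.mkℚᵘ (ℤ.+ k) 0
      ≈⟨ ℚᵘ.+-congʳ ℚᵘ.1ℚᵘ (ℚ.toℚᵘ-fromℚᵘ (ℚᵘ.mkℚᵘ (ℤ.+ k) 0)) ⟨
    ℚᵘ.1ℚᵘ ℚᵘ.+ toℚᵘ (ι k)  ≈⟨ ℚ.toℚᵘ-homo-+ 1ℚ (ι k) ⟨
    toℚᵘ (1ℚ + ι k)         ∎)
    where open ℚᵘ.≃-Reasoning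

  ι-nonNeg : ∀ k → 0ℚ ≤ ι k
  ι-nonNeg zero = ℚ.≤-refl
  ι-nonNeg (suc k) rewrite ι-suc k =
    ℚ.+-mono-≤ (ℚ.nonNegative⁻¹ 1ℚ) (ι-nonNeg k)

  0≤p*q : ∀ {p q} → 0ℚ ≤ p → 0ℚ ≤ q → 0ℚ ≤ p * q
  0≤p*q {p} {q} 0≤p 0≤q = ℚ.nonNegative⁻¹ (p * q)
    {{ℚ.nonNeg*nonNeg⇒nonNeg p {{nonNegative 0≤p}} q {{nonNegative 0≤q}}}}

  0≤p² : ∀ p → 0ℚ ≤ p * p
  0≤p² p with ℚ.≤-total 0ℚ p
  ... | inj₁ 0≤p = 0≤p*q 0≤p 0≤p
  ... | inj₂ p≤0 = ℚ.nonNegative⁻¹ (p * p)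
    {{ℚ.nonPos*nonPos⇒nonPos p {{nonPositive p≤0}} p {{nonPositive p≤0}}}}

  ι-positive : ∀ {k} → 1 ℕ.≤ k → Positive (ι k)
  ι-positive {suc k} _ = ℚ.normalize-pos (suc k) 1

  ι-mono-≤ : ∀ {j k} → j ℕ.≤ k → ι j ≤ ι k
  ι-mono-≤ {k = k} ℕ.z≤n = ι-nonNeg k
  ι-mono-≤ {suc j} {suc k} (ℕ.s≤s j≤k) =
    subst₂ _≤_ (sym (ι-suc j)) (sym (ι-suc k)) (ℚ.+-monoʳ-≤ 1ℚ (ι-mono-≤ j≤k))

  0≤p*q⇒0≤q : ∀ p {q} .{{_ : Positive p}} → 0ℚ ≤ p * q → 0ℚ ≤ q
  0≤p*q⇒0≤q p 0≤pq = ℚ.*-cancelˡ-≤-pos p (ℚ.≤-trans (ℚ.≤-reflexive (ℚ.*-zeroʳ p)) 0≤pq)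

  p*q≡0⇒q≤0 : ∀ p {q} .{{_ : Positive p}} → p * q ≡ 0ℚ → q ≤ 0ℚ
  p*q≡0⇒q≤0 p pq≡0 = ℚ.*-cancelˡ-≤-pos p (ℚ.≤-reflexive (trans pq≡0 (sym (ℚ.*-zeroʳ p))))

  p≤q⇒0≤q-p : ∀ {p q} → p ≤ q → 0ℚ ≤ q - p
  p≤q⇒0≤q-p {p} {q} p≤q = subst (_≤ q - p) (ℚ.+-inverseʳ p) (ℚ.+-monoˡ-≤ (- p) p≤q)

  p≤∣p∣ : ∀ p → p ≤ ∣ p ∣
  p≤∣p∣ p with ℚ.≤-total 0ℚ p
  ... | inj₁ 0≤p = ℚ.≤-reflexive (sym (ℚ.0≤p⇒∣p∣≡p 0≤p))
  ... | inj₂ p≤0 = ℚ.≤-trans p≤0 (ℚ.0≤∣p∣ p)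

  -- Supplies the auxiliary tolerance `η` for which an error of size `η * C` uses up exactly `ε`.
  quotient : ∀ ε → 0ℚ < ε → ∀ C → Positive C → ∃[ η ] 0ℚ < η × η * C ≡ ε
  quotient ε 0<ε C C>0 = ε * C⁻¹
    , ℚ.positive⁻¹ (ε * C⁻¹) {{ℚ.pos*pos⇒pos ε {{positive 0<ε}} C⁻¹ {{ℚ.1/pos⇒pos C {{C>0}}}}}}
    , trans (ℚ.*-assoc ε C⁻¹ C) (trans (cong (λ t → ε * t) (ℚ.*-inverseˡ C {{C≢0}})) (ℚ.*-identityʳ ε))
    where
    C≢0 : NonZero C
    C≢0 = ℚ.pos⇒nonZero C {{C>0}}
    C⁻¹ : ℚ
    C⁻¹ = (1/ C) {{C≢0}}

  -- Three summands cover every expansion below. Shorter ones are padded with a term of coefficient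
  -- 0, which explains the stray `0ℚ` multiples in later statements.
  ∑-lincomb : ∀ {n} a b c (f g h : Fin n → ℚ) →
    sum (λ i → a * f i + b * g i + c * h i) ≡ a * sum f + b * sum g + c * sum h
  ∑-lincomb {zero} a b c _ _ _ = solve 3 (λ a b c →
    con 0ℚ := a :* con 0ℚ :+ b :* con 0ℚ :+ c :* con 0ℚ) refl a b c
  ∑-lincomb {suc n} a b c f g h = trans
    (cong (λ t → (a * f Fin.zero + b * g Fin.zero + c * h Fin.zero) + t)
      (∑-lincomb a b c (f ∘ Fin.suc) (g ∘ Fin.suc) (h ∘ Fin.suc)))
    (solve 9 (λ a b c f g h F G H →
      (a :* f :+ b :* g :+ c :* h) :+ (a :* F :+ b :* G :+ c :* H)
      := a :* (f :+ F) :+ b :* (g :+ G) :+ c :* (h :+ H)) refl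
      a b c (f Fin.zero) (g Fin.zero) (h Fin.zero)
      (sum (f ∘ Fin.suc)) (sum (g ∘ Fin.suc)) (sum (h ∘ Fin.suc)))

  ∑-scale : ∀ {n} a (f : Fin n → ℚ) → sum (λ i → a * f i) ≡ a * sum f
  ∑-scale a f = sym (*-distribˡ-sum a f)

  ∑-zero : ∀ {n} {f : Fin n → ℚ} → (∀ i → f i ≡ 0ℚ) → sum f ≡ 0ℚ
  ∑-zero {zero}  f≡0 = refl
  ∑-zero {suc n} f≡0 = cong₂ _+_ (f≡0 Fin.zero) (∑-zero (f≡0 ∘ Fin.suc))

  ∑-nonNeg : ∀ {n} {f : Fin n → ℚ} → (∀ i → 0ℚ ≤ f i) → 0ℚ ≤ sum f
  ∑-nonNeg {zero}  0≤f = ℚ.≤-refl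
  ∑-nonNeg {suc n} 0≤f = ℚ.+-mono-≤ (0≤f Fin.zero) (∑-nonNeg (0≤f ∘ Fin.suc))

  -- The Iverson bracket. It turns sums over filtered lists into weighted sums over all vertices, so
  -- that the order of a double sum can be exchanged freely.
  ⟦_⟧ : ∀ {P : Set} → Dec P → ℚ
  ⟦ p? ⟧ = if does p? then 1ℚ else 0ℚ

  ⟦⟧-nonNeg : ∀ {P : Set} (p? : Dec P) → 0ℚ ≤ ⟦ p? ⟧
  ⟦⟧-nonNeg (yes _) = ℚ.nonNegative⁻¹ 1ℚ
  ⟦⟧-nonNeg (no _)  = ℚ.≤-refl

  ⟦⟧-idem : ∀ {P : Set} (p? : Dec P) → ⟦ p? ⟧ * ⟦ p? ⟧ ≡ ⟦ p? ⟧
  ⟦⟧-idem (yes _) = refl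
  ⟦⟧-idem (no _)  = refl

  ⟦⟧-× : ∀ {P Q : Set} (p? : Dec P) (q? : Dec Q) → ⟦ p? ×-dec q? ⟧ ≡ ⟦ p? ⟧ * ⟦ q? ⟧
  ⟦⟧-× (yes _) (yes _) = refl
  ⟦⟧-× (yes _) (no _)  = refl
  ⟦⟧-× (no _)  (yes _) = refl
  ⟦⟧-× (no _)  (no _)  = refl

  foldr-filter-allFin : ∀ {n} {P : Pred (Fin n) 0ℓ} (P? : Decidable P) (h : Fin n → ℚ) →
    List.foldr _+_ 0ℚ (List.map h (filter P? (allFin n))) ≡ sum (λ i → ⟦ P? i ⟧ * h i)
  foldr-filter-allFin {n} {P} P? h = go id
    where
    -- The tail of `allFin n` is tabulated by `Fin.suc` and is no longer of the form `allFin`, so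
    -- the induction runs over an arbitrary tabulated function.
    go : ∀ {m} (t : Fin m → Fin n) →
      List.foldr _+_ 0ℚ (List.map h (filter P? (List.tabulate t))) ≡
      sum (λ i → ⟦ P? (t i) ⟧ * h (t i))
    go {zero}  t = refl
    go {suc m} t with P? (t Fin.zero)
    ... | yes _ = cong₂ _+_ (sym (ℚ.*-identityˡ (h (t Fin.zero)))) (go (t ∘ Fin.suc))
    ... | no  _ = trans (go (t ∘ Fin.suc)) (trans (sym (ℚ.+-identityˡ _))
                    (cong₂ _+_ (sym (ℚ.*-zeroˡ (h (t Fin.zero)))) refl))

  ∑-⟦⟧ : ∀ {n} {P : Pred (Fin n) 0ℓ} (P? : Decidable P) →
    sum (λ i → ⟦ P? i ⟧) ≡ ι (length (filter P? (allFin n)))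
  ∑-⟦⟧ {n} {P} P? = begin
    sum (λ i → ⟦ P? i ⟧)            ≡⟨ sum-cong-≗ (λ i → ℚ.*-identityʳ ⟦ P? i ⟧) ⟨
    sum (λ i → ⟦ P? i ⟧ * 1ℚ)       ≡⟨ foldr-filter-allFin P? (λ _ → 1ℚ) ⟨
    List.foldr _+_ 0ℚ (List.map (λ _ → 1ℚ) (filter P? (allFin n))) ≡⟨ count (filter P? (allFin n)) ⟩
    ι (length (filter P? (allFin n))) ∎
    where
    open ≡-Reasoning
    count : ∀ (xs : List (Fin n)) → List.foldr _+_ 0ℚ (List.map (λ _ → 1ℚ) xs) ≡ ι (length xs)
    count []       = refl
    count (_ ∷ xs) = trans (cong (1ℚ +_) (count xs)) (sym (ι-suc (length xs)))

  ∑-δ : ∀ {n} (x : Fin n) (h : Fin n → ℚ) → sum (λ z → ⟦ x Fin.≟ z ⟧ * h z) ≡ h x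
  ∑-δ {suc n} Fin.zero h = begin
    1ℚ * h Fin.zero + sum (λ i → 0ℚ * h (Fin.suc i))
      ≡⟨ cong₂ _+_ (ℚ.*-identityˡ (h Fin.zero)) (∑-zero (λ i → ℚ.*-zeroˡ (h (Fin.suc i)))) ⟩
    h Fin.zero + 0ℚ ≡⟨ ℚ.+-identityʳ (h Fin.zero) ⟩
    h Fin.zero      ∎
    where open ≡-Reasoning
  ∑-δ {suc n} (Fin.suc x) h = begin
    0ℚ * h Fin.zero + sum (λ i → ⟦ Fin.suc x Fin.≟ Fin.suc i ⟧ * h (Fin.suc i))
      ≡⟨ cong₂ _+_ (ℚ.*-zeroˡ (h Fin.zero)) (∑-δ x (h ∘ Fin.suc)) ⟩
    0ℚ + h (Fin.suc x)  ≡⟨ ℚ.+-identityˡ (h (Fin.suc x)) ⟩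
    h (Fin.suc x)       ∎
    where open ≡-Reasoning

open Sums

-- The operators Δ, Γ and Γ₂ on rational-valued functions, for edge weights `e`.

module Discrete {n : ℕ} (e : Fin n → Fin n → ℚ) where
  open import Data.Rational.Base hiding (ℚ; 0ℚ; 1ℚ; ½)
  open ≡-Reasoning

  Δ Q : (Fin n → ℚ) → Fin n → ℚ
  Γ Γ₂ : (f g : Fin n → ℚ) → Fin n → ℚ
  Δ f x = sum (λ y → e x y * (f y - f x))
  Γ f g x = ½ * (Δ (λ y → f y * g y) x - f x * Δ g x - g x * Δ f x)
  Γ₂ f g x = ½ * (Δ (Γ f g) x - Γ f (Δ g) x - Γ (Δ f) g x)

  Q f x = sum (λ y → e x y * ((f y - f x) * (f y - f x)))

  -- The slack in the curvature-dimension inequality for the constant `K`, with `r` in the place of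
  -- the reciprocal of the dimension.
  gap : (f : Fin n → ℚ) (x : Fin n) (r K : ℚ) → ℚ
  gap f x r K = Γ₂ f f x - (r * (Δ f x * Δ f x) + K * Γ f f x)

  -- The discrete product rule: the product of the two differences is the difference of the products
  -- minus `f x` times the difference of `h` and `h x` times the difference of `f`.
  Γ-bilinear : ∀ f h x → Γ f h x ≡ ½ * sum (λ y → e x y * ((f y - f x) * (h y - h x)))
  Γ-bilinear f h x = cong (½ *_) (begin
    F - f x * H - h x * G
      ≡⟨ solve 5 (λ F G H a b → F :- a :* H :- b :* G :=
           con 1ℚ :* F :+ (:- a) :* H :+ (:- b) :* G) refl F G H (f x) (h x) ⟩
    1ℚ * F + (- f x) * H + (- h x) * G
      ≡⟨ ∑-lincomb {n} 1ℚ (- f x) (- h x) _ _ _ ⟨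
    sum (λ y → 1ℚ * (e x y * (f y * h y - f x * h x)) + (- f x) * (e x y * (h y - h x))
            + (- h x) * (e x y * (f y - f x)))
      ≡⟨ sum-cong-≗ (λ y → solve 5 (λ e a b c d →
           con 1ℚ :* (e :* (a :* b :- c :* d)) :+ (:- c) :* (e :* (b :- d)) :+ (:- d) :* (e :* (a :- c))
           := e :* ((a :- c) :* (b :- d))) refl (e x y) (f y) (h y) (f x) (h x)) ⟩
    sum (λ y → e x y * ((f y - f x) * (h y - h x))) ∎)
    where
    F = Δ (λ y → f y * h y) x
    G = Δ f x
    H = Δ h x

  Γ-self : ∀ f x → Γ f f x ≡ ½ * Q f x
  Γ-self f x = Γ-bilinear f f x

  -- The factor 4 clears the ½ of Γ₂ and the ½ of the inner Γ. The two mixed terms agree by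
  -- symmetry, whence the coefficient 2.
  4Γ₂ : ∀ f x → 4ℚ * Γ₂ f f x ≡
    sum (λ y → e x y * (Q f y - Q f x - 2ℚ * ((f y - f x) * (Δ f y - Δ f x))))
  4Γ₂ f x = begin
    4ℚ * (½ * (Δ (Γ f f) x - Γ f (Δ f) x - Γ (Δ f) f x))
      ≡⟨ cong₂ (λ p q → 4ℚ * (½ * (Δ (Γ f f) x - p - q)))
           (Γ-bilinear f (Δ f) x) (Γ-bilinear (Δ f) f x) ⟩
    4ℚ * (½ * (Δ (Γ f f) x - ½ * M - ½ * M′))
      ≡⟨ solve 3 (λ L M M′ → con 4ℚ :* (con ½ :* (L :- con ½ :* M :- con ½ :* M′)) :=
           con 2ℚ :* L :+ con (- 1ℚ) :* M :+ con (- 1ℚ) :* M′) refl (Δ (Γ f f) x) M M′ ⟩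
    2ℚ * Δ (Γ f f) x + (- 1ℚ) * M + (- 1ℚ) * M′
      ≡⟨ ∑-lincomb {n} 2ℚ (- 1ℚ) (- 1ℚ) _ _ _ ⟨
    sum (λ y → 2ℚ * (e x y * (Γ f f y - Γ f f x)) + (- 1ℚ) * m y + (- 1ℚ) * m′ y)
      ≡⟨ sum-cong-≗ (λ y → trans
           (cong₂ (λ p q → 2ℚ * (e x y * (p - q)) + (- 1ℚ) * m y + (- 1ℚ) * m′ y)
             (Γ-self f y) (Γ-self f x))
           (solve 5 (λ e p q a b →
             con 2ℚ :* (e :* (con ½ :* p :- con ½ :* q))
               :+ con (- 1ℚ) :* (e :* (a :* b)) :+ con (- 1ℚ) :* (e :* (b :* a))
             := e :* (p :- q :- con 2ℚ :* (a :* b))) refl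
             (e x y) (Q f y) (Q f x) (f y - f x) (Δ f y - Δ f x))) ⟩
    sum (λ y → e x y * (Q f y - Q f x - 2ℚ * ((f y - f x) * (Δ f y - Δ f x)))) ∎
    where
    m m′ : Fin n → ℚ
    m  y = e x y * ((f y - f x) * (Δ f y - Δ f x))
    m′ y = e x y * ((Δ f y - Δ f x) * (f y - f x))
    M M′ : ℚ
    M  = sum m
    M′ = sum m′

-- What the girth says about triangles, the degree and β.

module Combinatorics where

  2≤length : ∀ {A : Set} {y z : A} {xs} → y ∈ xs → z ∈ xs → y ≢ z → 2 ℕ.≤ length xs
  2≤length (here refl)       (here refl)       y≢z = ⊥-elim (y≢z refl)
  2≤length (here _)          (there (here _))  _   = ℕ.s≤s (ℕ.s≤s ℕ.z≤n)
  2≤length (here _)          (there (there _)) _   = ℕ.s≤s (ℕ.s≤s ℕ.z≤n)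
  2≤length (there (here _))  _                 _   = ℕ.s≤s (ℕ.s≤s ℕ.z≤n)
  2≤length (there (there _)) _                 _   = ℕ.s≤s (ℕ.s≤s ℕ.z≤n)

  two-elements : ∀ {A : Set} (xs : List A) → Unique xs → 2 ℕ.≤ length xs →
    ∃[ y ] ∃[ z ] y ∈ xs × z ∈ xs × y ≢ z
  two-elements (y ∷ z ∷ _) ((y≢z ∷ _) ∷ _) _ = y , z , here refl , there (here refl) , y≢z
  two-elements (_ ∷ [])    _               (ℕ.s≤s ())

  module _ {n : ℕ} (G : SimpleGraph n) where
    open SimpleGraph G

    TriangleFree : Set
    TriangleFree = ∀ {x y z} → x ∼ y → y ∼ z → x ∼ z → ⊥

    ∼⇒≢ : ∀ {x y} → x ∼ y → x ≢ y
    ∼⇒≢ x∼y x≡y = irrefl x≡y x∼y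

    triangle : ∀ {x y z} → x ∼ y → y ∼ z → x ∼ z → HasCycle G 3
    triangle {x} {y} {z} x∼y y∼z x∼z =
        ℕ.≤-refl
      , Vec.lookup (x ∷ y ∷ z ∷ [])
      , Vec.lookup-injective ((∼⇒≢ x∼y ∷ ∼⇒≢ x∼z ∷ []) ∷ (∼⇒≢ y∼z ∷ []) ∷ [] ∷ []) _ _
      , (λ { 0F → x∼y ; 1F → y∼z })
      , ∼-sym x∼z

    quadrilateral : ∀ {x y z w} → x ∼ y → y ∼ z → z ∼ w → w ∼ x → x ≢ z → y ≢ w → HasCycle G 4
    quadrilateral {x} {y} {z} {w} x∼y y∼z z∼w w∼x x≢z y≢w =
        ℕ.n≤1+n 3
      , Vec.lookup (x ∷ y ∷ z ∷ w ∷ [])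
      , Vec.lookup-injective
          ((∼⇒≢ x∼y ∷ x≢z ∷ ∼⇒≢ (∼-sym w∼x) ∷ []) ∷ (∼⇒≢ y∼z ∷ y≢w ∷ []) ∷ (∼⇒≢ z∼w ∷ []) ∷ [] ∷ []) _ _
      , (λ { 0F → x∼y ; 1F → y∼z ; 2F → z∼w })
      , w∼x

    girth≥4⇒triangle-free : ∀ {g} → Girth G g → 4 ℕ.≤ g → TriangleFree
    girth≥4⇒triangle-free (_ , shortest) 4≤g x∼y y∼z x∼z =
      ℕ.<-irrefl refl (ℕ.≤-trans 4≤g (shortest 3 (triangle x∼y y∼z x∼z)))

    ∈-neighbours⁺ : ∀ {x y} → x ∼ y → y ∈ neighbours G x
    ∈-neighbours⁺ {x} x∼y = ∈-filter⁺ (x ∼?_) (∈-allFin _) x∼y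

    neighbours-unique : ∀ x → Unique (neighbours G x)
    neighbours-unique x = Unique.filter⁺ (x ∼?_) (Unique.allFin⁺ n)

    ∈-commonNeighbours⁺ : ∀ {x z y} → x ∼ y → z ∼ y → y ∈ commonNeighbours G x z
    ∈-commonNeighbours⁺ {x} {z} x∼y z∼y =
      ∈-filter⁺ (λ y → (x ∼? y) ×-dec (z ∼? y)) (∈-allFin _) (x∼y , z∼y)

    ∈-commonNeighbours⁻ : ∀ {x z y} → y ∈ commonNeighbours G x z → x ∼ y × z ∼ y
    ∈-commonNeighbours⁻ {x} {z} y∈ =
      proj₂ (∈-filter⁻ (λ y → (x ∼? y) ×-dec (z ∼? y)) {xs = allFin n} y∈)

    commonNeighbours-unique : ∀ x z → Unique (commonNeighbours G x z)
    commonNeighbours-unique x z =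
      Unique.filter⁺ (λ y → (x ∼? y) ×-dec (z ∼? y)) (Unique.allFin⁺ n)

    module _ {d α β : ℕ} (srg : StronglyRegular G d α β) where
      open StronglyRegular srg

      2≤degree : ∀ {x y z} → x ∼ y → x ∼ z → y ≢ z → 2 ℕ.≤ d
      2≤degree {x} x∼y x∼z y≢z = ℕ.≤-trans
        (2≤length (∈-neighbours⁺ x∼y) (∈-neighbours⁺ x∼z) y≢z) (ℕ.≤-reflexive (regular x))

      two-neighbours : 2 ℕ.≤ d → ∀ x → ∃[ y ] ∃[ z ] x ∼ y × x ∼ z × y ≢ z
      two-neighbours 2≤d x =
        let y , z , y∈ , z∈ , y≢z = two-elements (neighbours G x) (neighbours-unique x)
              (ℕ.≤-trans 2≤d (ℕ.≤-reflexive (sym (regular x))))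
        in y , z , adj y∈ , adj z∈ , y≢z
        where
        adj : ∀ {y} → y ∈ neighbours G x → x ∼ y
        adj y∈ = proj₂ (∈-filter⁻ (x ∼?_) {xs = allFin n} y∈)

      -- A shortest cycle contains a vertex `c 1F` with the distinct neighbours `c 0F` and `c 2F`;
      -- every degree equals `d`.
      girth≥4⇒2≤d : ∀ {g} → Girth G g → 4 ℕ.≤ g → 2 ℕ.≤ d
      girth≥4⇒2≤d {suc (suc (suc _))} ((_ , c , inj , step , _) , _) _ =
        2≤degree (∼-sym (step 0F)) (step 1F) λ c₀≡c₂ → case inj c₀≡c₂ of λ ()
      girth≥4⇒2≤d {suc (suc zero)} _ (ℕ.s≤s (ℕ.s≤s ()))
      girth≥4⇒2≤d {suc zero} _ (ℕ.s≤s ())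

      -- Opposite vertices of a 4-cycle are non-adjacent, as there are no triangles, and they share
      -- the two remaining vertices of the cycle.
      girth4⇒2≤β : Girth G 4 → 2 ℕ.≤ β
      girth4⇒2≤β girth@((_ , c , inj , step , close) , _) = ℕ.≤-trans
        (2≤length (∈-commonNeighbours⁺ {c 0F} {c 2F} (step 0F) (∼-sym (step 1F)))
                  (∈-commonNeighbours⁺ (∼-sym close) (step 2F))
                  (λ c₁≡c₃ → case inj c₁≡c₃ of λ ()))
        (ℕ.≤-reflexive (nonadjacent (c 0F) (c 2F)
          (λ c₀≡c₂ → case inj c₀≡c₂ of λ ())
          (girth≥4⇒triangle-free girth ℕ.≤-refl (step 0F) (step 1F))))

      -- Two vertices at distance two on the 5-cycle are non-adjacent. If they had two common
      -- neighbours, these would complete a 4-cycle, shorter than the girth.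
      girth5⇒β≡1 : Girth G 5 → β ≡ 1
      girth5⇒β≡1 girth@((_ , c , inj , step , _) , shortest) with ℕ.m≤n⇒m<n∨m≡n β≥1
      ... | inj₂ 1≡β = sym 1≡β
      ... | inj₁ 2≤β =
        let c₀≢c₂ = λ c₀≡c₂ → case inj {0F} {2F} c₀≡c₂ of λ ()
            y , w , y∈ , w∈ , y≢w = two-elements (commonNeighbours G (c 0F) (c 2F))
              (commonNeighbours-unique (c 0F) (c 2F))
              (ℕ.≤-trans 2≤β (ℕ.≤-reflexive (sym (nonadjacent (c 0F) (c 2F) c₀≢c₂
                (girth≥4⇒triangle-free girth (ℕ.n≤1+n 4) (step 0F) (step 1F))))))
            c₀∼y , c₂∼y = ∈-commonNeighbours⁻ y∈
            c₀∼w , c₂∼w = ∈-commonNeighbours⁻ w∈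
        in ⊥-elim (ℕ.<-irrefl refl (shortest 4
             (quadrilateral c₀∼y (∼-sym c₂∼y) c₂∼w (∼-sym c₀∼w) c₀≢c₂ y≢w)))

open Combinatorics

-- Matrix identities for a triangle-free strongly regular graph.

adjacency : ∀ {n} → SimpleGraph n → Fin n → Fin n → ℚ
adjacency G x y = ⟦ SimpleGraph._∼?_ G x y ⟧

module TriangleFreeSRG {n d α β : ℕ} (G : SimpleGraph n) (srg : StronglyRegular G d α β)
  (triangle-free : TriangleFree G)
  where
  open import Data.Rational.Base hiding (ℚ; 0ℚ; 1ℚ; ½)
  open SimpleGraph G
  open StronglyRegular srg
  open ≡-Reasoning

  D b : ℚ
  D = ι d
  b = ι β

  -- As β ≥ 1, every vertex other than `x` and its neighbours has a common neighbour with `x`. Hence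
  -- `δ x`, `e x` and `w x` are the indicators of the spheres of radius 0, 1 and 2 about `x`.
  e δ w : Fin n → Fin n → ℚ
  e = adjacency G
  δ x y = ⟦ x Fin.≟ y ⟧
  w x y = ⟦ ¬? (x Fin.≟ y) ×-dec ¬? (x ∼? y) ⟧

  open Discrete e

  e-sym : ∀ x y → e x y ≡ e y x
  e-sym x y with x ∼? y | y ∼? x
  ... | yes _ | yes _ = refl
  ... | yes p | no ¬q = ⊥-elim (¬q (∼-sym p))
  ... | no ¬p | yes q = ⊥-elim (¬p (∼-sym q))
  ... | no _  | no _  = refl

  e-irrefl : ∀ x → e x x ≡ 0ℚ
  e-irrefl x with x ∼? x
  ... | yes p = ⊥-elim (irrefl refl p)
  ... | no _  = refl

  w-irrefl : ∀ x → w x x ≡ 0ℚ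
  w-irrefl x with x Fin.≟ x
  ... | yes _  = refl
  ... | no x≢x = ⊥-elim (x≢x refl)

  w*e : ∀ x y → w x y * e x y ≡ 0ℚ
  w*e x y with x Fin.≟ y | x ∼? y
  ... | yes _ | yes _ = refl
  ... | yes _ | no _  = refl
  ... | no _  | yes _ = refl
  ... | no _  | no _  = refl

  partition : ∀ x y → δ x y + e x y + w x y ≡ 1ℚ
  partition x y with x Fin.≟ y | x ∼? y
  ... | yes refl | yes p = ⊥-elim (irrefl refl p)
  ... | yes _ | no _  = refl
  ... | no _  | yes _ = refl
  ... | no _  | no _  = refl

  e*e*e : ∀ x y z → e x y * e y z * e x z ≡ 0ℚ
  e*e*e x y z with x ∼? y | y ∼? z | x ∼? z
  ... | yes p | yes q | yes r = ⊥-elim (triangle-free p q r)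
  ... | yes _ | yes _ | no _  = refl
  ... | yes _ | no _  | yes _ = refl
  ... | yes _ | no _  | no _  = refl
  ... | no _  | yes _ | yes _ = refl
  ... | no _  | yes _ | no _  = refl
  ... | no _  | no _  | yes _ = refl
  ... | no _  | no _  | no _  = refl

  degree : ∀ x → sum (e x) ≡ D
  degree x = trans (∑-⟦⟧ (x ∼?_)) (cong ι (regular x))

  ∑-δ-zero : ∀ x (h : Fin n → ℚ) → h x ≡ 0ℚ → ∀ z → δ x z * h z ≡ 0ℚ
  ∑-δ-zero x h hx≡0 z with x Fin.≟ z
  ... | yes refl = trans (ℚ.*-identityˡ (h x)) hx≡0
  ... | no _     = ℚ.*-zeroˡ (h z)

  -- The strongly regular equation for the square of the adjacency matrix. There is no contribution
  -- from adjacent pairs, because a common neighbour of the ends of an edge would form a triangle.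
  paths : ∀ x z → sum (λ y → e x y * e y z) ≡ D * δ x z + b * w x z
  paths x z with x Fin.≟ z
  ... | yes refl = begin
    sum (λ y → e x y * e y x)
      ≡⟨ sum-cong-≗ (λ y → trans (cong (λ t → e x y * t) (e-sym y x)) (⟦⟧-idem (x ∼? y))) ⟩
    sum (e x)             ≡⟨ degree x ⟩
    D                     ≡⟨ solve 2 (λ D b → D := D :* con 1ℚ :+ b :* con 0ℚ) refl D b ⟩
    D * 1ℚ + b * 0ℚ       ∎
  ... | no x≢z with x ∼? z
  ...   | yes x∼z = begin
    sum (λ y → e x y * e y z)  ≡⟨ ∑-zero vanish ⟩
    0ℚ   ≡⟨ solve 2 (λ D b → con 0ℚ := D :* con 0ℚ :+ b :* con 0ℚ) refl D b ⟩
    D * 0ℚ + b * 0ℚ       ∎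
    where
    vanish : ∀ y → e x y * e y z ≡ 0ℚ
    vanish y with x ∼? y | y ∼? z
    ... | yes p | yes q = ⊥-elim (triangle-free p q x∼z)
    ... | yes _ | no _  = refl
    ... | no _  | yes _ = refl
    ... | no _  | no _  = refl
  ...   | no x≁z = begin
    sum (λ y → e x y * e y z)
      ≡⟨ sum-cong-≗ (λ y → trans (cong (λ t → e x y * t) (e-sym y z)) (sym (⟦⟧-× (x ∼? y) (z ∼? y)))) ⟩
    sum (λ y → ⟦ (x ∼? y) ×-dec (z ∼? y) ⟧)
      ≡⟨ trans (∑-⟦⟧ (λ y → (x ∼? y) ×-dec (z ∼? y))) (cong ι (nonadjacent x z x≢z x≁z)) ⟩
    b                ≡⟨ solve 2 (λ D b → b := D :* con 0ℚ :+ b :* con 1ℚ) refl D b ⟩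
    D * 0ℚ + b * 1ℚ  ∎

  -- The sum-of-squares identity for Γ₂ at a vertex.

  module At (x : Fin n) (f : Fin n → ℚ) where

    g s p : Fin n → ℚ
    g y = f y - f x
    p y = e x y * g y
    s z = sum (λ y → e y z * p y)

    A q : ℚ
    A = Δ f x
    q = Q f x

    S T₁ T₂ T₃ : ℚ
    S  = sum (λ z → w x z * ((b * g z - 2ℚ * s z) * (b * g z - 2ℚ * s z)))
    T₁ = sum (λ z → w x z * (g z * g z))
    T₂ = sum (λ z → w x z * (g z * s z))
    T₃ = sum (λ z → w x z * (s z * s z))

    P₁ P₂ : Fin n → ℚ
    P₁ y = sum (λ z → e y z * g z)
    P₂ y = sum (λ z → e y z * (g z * g z))

    gx≡0 : g x ≡ 0ℚ
    gx≡0 = ℚ.+-inverseʳ (f x)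

    -- Writing `f z - f y` as `g z - g y` recentres all differences at `x`; regularity evaluates the
    -- term that is constant in `z`.
    Q-row : ∀ y → Q f y ≡ 1ℚ * P₂ y + (- 2ℚ * g y) * P₁ y + (g y * g y) * D
    Q-row y = begin
      Q f y
        ≡⟨ sum-cong-≗ (λ z → solve 4 (λ e fz fy fx →
             e :* ((fz :- fy) :* (fz :- fy)) :=
             con 1ℚ :* (e :* ((fz :- fx) :* (fz :- fx)))
               :+ (con (- 2ℚ) :* (fy :- fx)) :* (e :* (fz :- fx))
               :+ ((fy :- fx) :* (fy :- fx)) :* e) refl (e y z) (f z) (f y) (f x)) ⟩
      sum (λ z → 1ℚ * (e y z * (g z * g z)) + (- 2ℚ * g y) * (e y z * g z) + (g y * g y) * e y z)
        ≡⟨ ∑-lincomb {n} 1ℚ (- 2ℚ * g y) (g y * g y) _ _ _ ⟩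
      1ℚ * P₂ y + (- 2ℚ * g y) * P₁ y + (g y * g y) * sum (e y)
        ≡⟨ cong (λ t → 1ℚ * P₂ y + (- 2ℚ * g y) * P₁ y + (g y * g y) * t) (degree y) ⟩
      1ℚ * P₂ y + (- 2ℚ * g y) * P₁ y + (g y * g y) * D ∎

    Δ-row : ∀ y → Δ f y ≡ 1ℚ * P₁ y + (- g y) * D + 0ℚ * D
    Δ-row y = begin
      Δ f y
        ≡⟨ sum-cong-≗ (λ z → solve 4 (λ e fz fy fx →
             e :* (fz :- fy) := con 1ℚ :* (e :* (fz :- fx)) :+ (:- (fy :- fx)) :* e :+ con 0ℚ :* e)
             refl (e y z) (f z) (f y) (f x)) ⟩
      sum (λ z → 1ℚ * (e y z * g z) + (- g y) * e y z + 0ℚ * e y z)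
        ≡⟨ ∑-lincomb {n} 1ℚ (- g y) 0ℚ _ _ _ ⟩
      1ℚ * P₁ y + (- g y) * sum (e y) + 0ℚ * sum (e y)
        ≡⟨ cong (λ t → 1ℚ * P₁ y + (- g y) * t + 0ℚ * t) (degree y) ⟩
      1ℚ * P₁ y + (- g y) * D + 0ℚ * D ∎

    -- After the exchange of sums, each `g z * g z` is weighted by the number of two-step walks from
    -- `x` to `z`. By `paths` these end at `x`, where `g` vanishes, or on the second sphere, where
    -- there are β of them.
    ∑eP₂ : sum (λ y → e x y * P₂ y) ≡ b * T₁
    ∑eP₂ = begin
      sum (λ y → e x y * P₂ y)
        ≡⟨ sum-cong-≗ (λ y → sym (∑-scale {n} (e x y) _)) ⟩
      sum (λ y → sum (λ z → e x y * (e y z * (g z * g z))))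
        ≡⟨ ∑-comm {n} {n} (λ y z → e x y * (e y z * (g z * g z))) ⟩
      sum (λ z → sum (λ y → e x y * (e y z * (g z * g z))))
        ≡⟨ sum-cong-≗ (λ z → trans
             (sum-cong-≗ (λ y → solve 3 (λ a c h → a :* (c :* h) := h :* (a :* c)) refl
               (e x y) (e y z) (g z * g z)))
             (∑-scale {n} (g z * g z) _)) ⟩
      sum (λ z → (g z * g z) * sum (λ y → e x y * e y z))
        ≡⟨ sum-cong-≗ column ⟩
      sum (λ z → b * (w x z * (g z * g z)))
        ≡⟨ ∑-scale {n} b _ ⟩
      b * T₁ ∎
      where
      column : ∀ z → (g z * g z) * sum (λ y → e x y * e y z) ≡ b * (w x z * (g z * g z))
      column z = begin
        (g z * g z) * sum (λ y → e x y * e y z)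
          ≡⟨ cong (λ t → (g z * g z) * t) (paths x z) ⟩
        (g z * g z) * (D * δ x z + b * w x z)
          ≡⟨ solve 5 (λ g D δ b w → (g :* g) :* (D :* δ :+ b :* w)
               := D :* g :* (δ :* g) :+ b :* (w :* (g :* g))) refl (g z) D (δ x z) b (w x z) ⟩
        D * g z * (δ x z * g z) + b * (w x z * (g z * g z))
          ≡⟨ cong (λ t → D * g z * t + b * (w x z * (g z * g z))) (∑-δ-zero x g gx≡0 z) ⟩
        D * g z * 0ℚ + b * (w x z * (g z * g z))
          ≡⟨ solve 3 (λ D g t → D :* g :* con 0ℚ :+ t := t) refl D (g z) (b * (w x z * (g z * g z))) ⟩
        b * (w x z * (g z * g z)) ∎

    -- A neighbour of `x` has no common neighbour with `x`, so each term contains the three sides of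
    -- a triangle.
    e*s : ∀ z → e x z * s z ≡ 0ℚ
    e*s z = trans (sym (∑-scale {n} (e x z) _)) (∑-zero (λ y → begin
      e x z * (e y z * (e x y * g y))
        ≡⟨ solve 4 (λ a c h g → a :* (c :* (h :* g)) := (h :* c :* a) :* g) refl
             (e x z) (e y z) (e x y) (g y) ⟩
      (e x y * e y z * e x z) * g y  ≡⟨ cong (λ t → t * g y) (e*e*e x y z) ⟩
      0ℚ * g y                       ≡⟨ ℚ.*-zeroˡ (g y) ⟩
      0ℚ                             ∎))

    s-at-x : s x ≡ A
    s-at-x = sum-cong-≗ (λ y → begin
      e y x * (e x y * g y)  ≡⟨ cong (λ t → t * (e x y * g y)) (e-sym y x) ⟩
      e x y * (e x y * g y)  ≡⟨ ℚ.*-assoc (e x y) (e x y) (g y) ⟨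
      e x y * e x y * g y    ≡⟨ cong (λ t → t * g y) (⟦⟧-idem (x ∼? y)) ⟩
      e x y * g y            ∎)

    split : ∀ z (h : ℚ) → h ≡ δ x z * h + e x z * h + w x z * h
    split z h = begin
      h                                    ≡⟨ ℚ.*-identityˡ h ⟨
      1ℚ * h                               ≡⟨ cong (λ t → t * h) (partition x z) ⟨
      (δ x z + e x z + w x z) * h          ≡⟨ solve 4 (λ a c d h → (a :+ c :+ d) :* h := a :* h :+ c :* h :+ d :* h) refl
          (δ x z) (e x z) (w x z) h ⟩
      δ x z * h + e x z * h + w x z * h    ∎

    -- Only the second sphere survives: `g` vanishes at `x`, and `s` vanishes on the first sphere.
    ∑gs : sum (λ z → g z * s z) ≡ T₂
    ∑gs = sum-cong-≗ (λ z → begin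
      g z * s z ≡⟨ split z (g z * s z) ⟩
      δ x z * (g z * s z) + e x z * (g z * s z) + w x z * (g z * s z)
        ≡⟨ solve 5 (λ a c d g s → a :* (g :* s) :+ c :* (g :* s) :+ d :* (g :* s)
             := (a :* g) :* s :+ (c :* s) :* g :+ d :* (g :* s)) refl (δ x z) (e x z) (w x z) (g z) (s z) ⟩
      (δ x z * g z) * s z + (e x z * s z) * g z + w x z * (g z * s z)
        ≡⟨ cong₂ (λ u v → u * s z + v * g z + w x z * (g z * s z)) (∑-δ-zero x g gx≡0 z) (e*s z) ⟩
      0ℚ * s z + 0ℚ * g z + w x z * (g z * s z)
        ≡⟨ solve 3 (λ s g t → con 0ℚ :* s :+ con 0ℚ :* g :+ t := t) refl (s z) (g z) (w x z * (g z * s z)) ⟩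
      w x z * (g z * s z) ∎)

    ∑egP₁ : sum (λ y → p y * P₁ y) ≡ T₂
    ∑egP₁ = begin
      sum (λ y → p y * P₁ y)
        ≡⟨ sum-cong-≗ (λ y → sym (∑-scale {n} (p y) _)) ⟩
      sum (λ y → sum (λ z → p y * (e y z * g z)))
        ≡⟨ ∑-comm {n} {n} (λ y z → p y * (e y z * g z)) ⟩
      sum (λ z → sum (λ y → p y * (e y z * g z)))
        ≡⟨ sum-cong-≗ (λ z → trans
             (sum-cong-≗ (λ y → solve 3 (λ a c h → a :* (c :* h) := h :* (c :* a)) refl (p y) (e y z) (g z)))
             (∑-scale {n} (g z) _)) ⟩
      sum (λ z → g z * s z)  ≡⟨ ∑gs ⟩
      T₂ ∎

    p²-sum : sum (λ y → p y * p y) ≡ q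
    p²-sum = sum-cong-≗ (λ y → begin
      e x y * g y * (e x y * g y)  ≡⟨ solve 2 (λ e g → e :* g :* (e :* g) := (e :* e) :* (g :* g)) refl
          (e x y) (g y) ⟩
      e x y * e x y * (g y * g y)  ≡⟨ cong (λ t → t * (g y * g y)) (⟦⟧-idem (x ∼? y)) ⟩
      e x y * (g y * g y)          ∎)

    -- With M the adjacency matrix, `s` is Mp and the sum is the quadratic form of M² at `p`. Here
    -- M² is D times the identity plus b times the matrix of `w`, and `partition` rewrites `w` as
    -- all-ones minus identity minus M. The all-ones matrix produces the square of `A`, and the term
    -- in M drops out because `p` and `s` have disjoint supports.
    ∑s² : sum (λ z → s z * s z) ≡ (D - b) * q + b * (A * A)
    ∑s² = begin
      sum (λ z → s z * s z)
        ≡⟨ sum-cong-≗ (λ z → sym (∑-scale {n} (s z) _)) ⟩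
      sum (λ z → sum (λ y → s z * (e y z * p y)))
        ≡⟨ ∑-comm {n} {n} (λ z y → s z * (e y z * p y)) ⟩
      sum (λ y → sum (λ z → s z * (e y z * p y)))
        ≡⟨ sum-cong-≗ row ⟩
      sum (λ y → (D - b) * (p y * p y) + (b * A) * p y + 0ℚ * p y)
        ≡⟨ ∑-lincomb {n} (D - b) (b * A) 0ℚ _ _ _ ⟩
      (D - b) * sum (λ y → p y * p y) + (b * A) * A + 0ℚ * A
        ≡⟨ cong (λ t → (D - b) * t + (b * A) * A + 0ℚ * A) p²-sum ⟩
      (D - b) * q + (b * A) * A + 0ℚ * A
        ≡⟨ solve 3 (λ u b A → u :+ (b :* A) :* A :+ con 0ℚ :* A := u :+ b :* (A :* A)) refl ((D - b) * q) b A ⟩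
      (D - b) * q + b * (A * A) ∎
      where
      p*s : ∀ y → p y * s y ≡ 0ℚ
      p*s y = trans (solve 3 (λ e g s → e :* g :* s := g :* (e :* s)) refl (e x y) (g y) (s y))
        (trans (cong (λ t → g y * t) (e*s y)) (ℚ.*-zeroʳ (g y)))
      w-as : ∀ y y′ → w y y′ ≡ 1ℚ - δ y y′ - e y y′
      w-as y y′ = trans (solve 3 (λ d e w → w := (d :+ e :+ w) :- d :- e) refl (δ y y′) (e y y′) (w y y′))
        (cong (λ t → t - δ y y′ - e y y′) (partition y y′))
      ∑se : ∀ y → sum (λ z → s z * e y z) ≡ (D - b) * p y + b * A + (- b) * s y
      ∑se y = begin
        sum (λ z → s z * e y z)
          ≡⟨ sum-cong-≗ (λ z → trans (ℚ.*-comm (s z) (e y z)) (sym (∑-scale {n} (e y z) _))) ⟩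
        sum (λ z → sum (λ y′ → e y z * (e y′ z * p y′)))
          ≡⟨ ∑-comm {n} {n} (λ z y′ → e y z * (e y′ z * p y′)) ⟩
        sum (λ y′ → sum (λ z → e y z * (e y′ z * p y′)))
          ≡⟨ sum-cong-≗ (λ y′ → trans
               (sum-cong-≗ (λ z → trans
                 (cong (λ t → e y z * (t * p y′)) (e-sym y′ z))
                 (solve 3 (λ a c h → a :* (c :* h) := h :* (a :* c)) refl (e y z) (e z y′) (p y′))))
               (trans (∑-scale {n} (p y′) _) (cong (λ t → p y′ * t)
                 (trans (paths y y′) (cong (λ t → D * δ y y′ + b * t) (w-as y y′)))))) ⟩
        sum (λ y′ → p y′ * (D * δ y y′ + b * (1ℚ - δ y y′ - e y y′)))
          ≡⟨ sum-cong-≗ (λ y′ → trans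
              (solve 5 (λ p D d b e → p :* (D :* d :+ b :* (con 1ℚ :- d :- e))
                 := (D :- b) :* (d :* p) :+ b :* p :+ (:- b) :* (e :* p)) refl
                 (p y′) D (δ y y′) b (e y y′))
              (cong (λ t → (D - b) * (δ y y′ * p y′) + b * p y′ + (- b) * (t * p y′)) (e-sym y y′))) ⟩
        sum (λ y′ → (D - b) * (δ y y′ * p y′) + b * p y′ + (- b) * (e y′ y * p y′))
          ≡⟨ ∑-lincomb {n} (D - b) b (- b) _ _ _ ⟩
        (D - b) * sum (λ y′ → δ y y′ * p y′) + b * A + (- b) * s y
          ≡⟨ cong (λ t → (D - b) * t + b * A + (- b) * s y) (∑-δ y p) ⟩
        (D - b) * p y + b * A + (- b) * s y ∎
      row : ∀ y → sum (λ z → s z * (e y z * p y)) ≡ (D - b) * (p y * p y) + (b * A) * p y + 0ℚ * p y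
      row y = begin
        sum (λ z → s z * (e y z * p y))
          ≡⟨ sum-cong-≗ (λ z → solve 3 (λ s e p → s :* (e :* p) := p :* (s :* e)) refl (s z) (e y z) (p y)) ⟩
        sum (λ z → p y * (s z * e y z))  ≡⟨ ∑-scale {n} (p y) _ ⟩
        p y * sum (λ z → s z * e y z)    ≡⟨ cong (λ t → p y * t) (∑se y) ⟩
        p y * ((D - b) * p y + b * A + (- b) * s y)
          ≡⟨ solve 5 (λ D b A p s → p :* ((D :- b) :* p :+ b :* A :+ (:- b) :* s)
               := (D :- b) :* (p :* p) :+ (b :* A) :* p :+ (:- b) :* (p :* s)) refl D b A (p y) (s y) ⟩
        (D - b) * (p y * p y) + (b * A) * p y + (- b) * (p y * s y)
          ≡⟨ cong (λ t → (D - b) * (p y * p y) + (b * A) * p y + (- b) * t) (p*s y) ⟩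
        (D - b) * (p y * p y) + (b * A) * p y + (- b) * 0ℚ
          ≡⟨ solve 3 (λ u b p → u :+ (:- b) :* con 0ℚ := u :+ con 0ℚ :* p) refl
              ((D - b) * (p y * p y) + (b * A) * p y) b (p y) ⟩
        (D - b) * (p y * p y) + (b * A) * p y + 0ℚ * p y ∎

    -- From the full sum of squares of `s`, the vertex `x` takes away the square of `s x`, which is
    -- that of `A`; the first sphere takes away nothing.
    T₃-value : T₃ ≡ (D - b) * q + b * (A * A) - A * A
    T₃-value = begin
      T₃
        ≡⟨ sum-cong-≗ pointwise ⟩
      sum (λ z → 1ℚ * (s z * s z) + (- 1ℚ) * (δ x z * (s z * s z)) + 0ℚ * s z)
        ≡⟨ ∑-lincomb {n} 1ℚ (- 1ℚ) 0ℚ _ _ _ ⟩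
      1ℚ * sum (λ z → s z * s z) + (- 1ℚ) * sum (λ z → δ x z * (s z * s z)) + 0ℚ * sum s
        ≡⟨ cong₂ (λ u v → 1ℚ * u + (- 1ℚ) * v + 0ℚ * sum s) ∑s²
             (trans (∑-δ x (λ z → s z * s z)) (cong₂ _*_ s-at-x s-at-x)) ⟩
      1ℚ * ((D - b) * q + b * (A * A)) + (- 1ℚ) * (A * A) + 0ℚ * sum s
        ≡⟨ solve 3 (λ u v t → con 1ℚ :* u :+ con (- 1ℚ) :* v :+ con 0ℚ :* t := u :- v) refl
             ((D - b) * q + b * (A * A)) (A * A) (sum s) ⟩
      (D - b) * q + b * (A * A) - A * A ∎
      where
      pointwise : ∀ z → w x z * (s z * s z) ≡ 1ℚ * (s z * s z) + (- 1ℚ) * (δ x z * (s z * s z)) + 0ℚ * s z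
      pointwise z = begin
        w x z * (s z * s z)
          ≡⟨ solve 4 (λ d e w s → w :* (s :* s)
               := (d :* (s :* s) :+ e :* (s :* s) :+ w :* (s :* s)) :- d :* (s :* s) :- (e :* s) :* s) refl
               (δ x z) (e x z) (w x z) (s z) ⟩
        (δ x z * (s z * s z) + e x z * (s z * s z) + w x z * (s z * s z)) - δ x z * (s z * s z) - (e x z * s z) * s z
          ≡⟨ cong₂ (λ u v → u - δ x z * (s z * s z) - v * s z) (sym (split z (s z * s z))) (e*s z) ⟩
        s z * s z - δ x z * (s z * s z) - 0ℚ * s z
          ≡⟨ solve 3 (λ u v s → u :- v :- con 0ℚ :* s := con 1ℚ :* u :+ con (- 1ℚ) :* v :+ con 0ℚ :* s) refl
               (s z * s z) (δ x z * (s z * s z)) (s z) ⟩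
        1ℚ * (s z * s z) + (- 1ℚ) * (δ x z * (s z * s z)) + 0ℚ * s z ∎

    S-expand : S ≡ (b * b) * T₁ + (- 4ℚ * b) * T₂ + 4ℚ * T₃
    S-expand = trans
      (sum-cong-≗ (λ z → solve 4 (λ w b g s →
        w :* ((b :* g :- con 2ℚ :* s) :* (b :* g :- con 2ℚ :* s)) :=
        (b :* b) :* (w :* (g :* g)) :+ (con (- 4ℚ) :* b) :* (w :* (g :* s)) :+ con 4ℚ :* (w :* (s :* s)))
        refl (w x z) b (g z) (s z)))
      (∑-lincomb {n} (b * b) (- 4ℚ * b) 4ℚ _ _ _)

    4Γ₂-value : 4ℚ * Γ₂ f f x ≡ b * T₁ - 4ℚ * T₂ + 2ℚ * D * q + 2ℚ * (A * A)
    4Γ₂-value = begin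
      4ℚ * Γ₂ f f x  ≡⟨ 4Γ₂ f x ⟩
      sum (λ y → e x y * (Q f y - q - 2ℚ * (g y * (Δ f y - A))))
        ≡⟨ sum-cong-≗ (λ y → trans
             (cong₂ (λ u v → e x y * (u - q - 2ℚ * (g y * (v - A)))) (Q-row y) (Δ-row y))
             (solve 7 (λ e g P₂ P₁ D q A →
               e :* ((con 1ℚ :* P₂ :+ (con (- 2ℚ) :* g) :* P₁ :+ (g :* g) :* D) :- q :-
                 con 2ℚ :* (g :* ((con 1ℚ :* P₁ :+ (:- g) :* D :+ con 0ℚ :* D) :- A)))
               := con 1ℚ :* (e :* P₂) :+ con (- 4ℚ) :* ((e :* g) :* P₁)
                  :+ con 1ℚ :* ((con (ι 3) :* D) :* (e :* (g :* g)) :+ (:- q) :* e :+ (con 2ℚ :* A) :* (e :* g)))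
               refl (e x y) (g y) (P₂ y) (P₁ y) D q A)) ⟩
      sum (λ y → 1ℚ * (e x y * P₂ y) + (- 4ℚ) * (p y * P₁ y) + 1ℚ * rest y)
        ≡⟨ ∑-lincomb {n} 1ℚ (- 4ℚ) 1ℚ _ _ _ ⟩
      1ℚ * sum (λ y → e x y * P₂ y) + (- 4ℚ) * sum (λ y → p y * P₁ y) + 1ℚ * sum rest
        ≡⟨ cong₂ (λ u v → 1ℚ * u + (- 4ℚ) * v + 1ℚ * sum rest) ∑eP₂ ∑egP₁ ⟩
      1ℚ * (b * T₁) + (- 4ℚ) * T₂ + 1ℚ * sum rest
        ≡⟨ cong (λ t → 1ℚ * (b * T₁) + (- 4ℚ) * T₂ + 1ℚ * t)
             (trans (∑-lincomb {n} (ι 3 * D) (- q) (2ℚ * A) _ _ _)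
               (cong (λ t → (ι 3 * D) * q + (- q) * t + (2ℚ * A) * A) (degree x))) ⟩
      1ℚ * (b * T₁) + (- 4ℚ) * T₂ + 1ℚ * ((ι 3 * D) * q + (- q) * D + (2ℚ * A) * A)
        ≡⟨ solve 5 (λ T₁ T₂ D q A →
             con 1ℚ :* T₁ :+ con (- 4ℚ) :* T₂ :+ con 1ℚ :* ((con (ι 3) :* D) :* q :+ (:- q) :* D :+ (con 2ℚ :* A) :* A)
             := T₁ :- con 4ℚ :* T₂ :+ con 2ℚ :* D :* q :+ con 2ℚ :* (A :* A)) refl (b * T₁) T₂ D q A ⟩
      b * T₁ - 4ℚ * T₂ + 2ℚ * D * q + 2ℚ * (A * A) ∎
      where
      rest : Fin n → ℚ
      -- The 3 collects one `D` from `Q-row` and two from the product of `g y` with `Δ-row`. Summing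
      -- the constant `- q` over the neighbours then takes one `D * q` back.
      rest y = (ι 3 * D) * (e x y * (g y * g y)) + (- q) * e x y + (2ℚ * A) * (e x y * g y)

    -- Multiplication by `b` makes the terms in `T₁` and `T₂` those of `S-expand`. The missing
    -- `4ℚ * T₃` is added and subtracted through `T₃-value`, which leaves only `q` and `A`.
    4bΓ₂ : b * (4ℚ * Γ₂ f f x) ≡ S + 2ℚ * (b - 2ℚ) * (D * q - A * A) + 4ℚ * b * q
    4bΓ₂ = begin
      b * (4ℚ * Γ₂ f f x)   ≡⟨ cong (λ t → b * t) 4Γ₂-value ⟩
      b * (b * T₁ - 4ℚ * T₂ + 2ℚ * D * q + 2ℚ * (A * A))
        ≡⟨ solve 6 (λ b D A q T₁ T₂ →
             b :* (b :* T₁ :- con 4ℚ :* T₂ :+ con 2ℚ :* D :* q :+ con 2ℚ :* (A :* A)) :=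
             ((b :* b) :* T₁ :+ (con (- 4ℚ) :* b) :* T₂ :+ con 4ℚ :* ((D :- b) :* q :+ b :* (A :* A) :- A :* A))
             :+ con 2ℚ :* (b :- con 2ℚ) :* (D :* q :- A :* A) :+ con 4ℚ :* b :* q)
             refl b D A q T₁ T₂ ⟩
      ((b * b) * T₁ + (- 4ℚ * b) * T₂ + 4ℚ * ((D - b) * q + b * (A * A) - A * A))
        + 2ℚ * (b - 2ℚ) * (D * q - A * A) + 4ℚ * b * q
        ≡⟨ cong (λ t → t + 2ℚ * (b - 2ℚ) * (D * q - A * A) + 4ℚ * b * q)
             (sym (trans S-expand (cong (λ t → (b * b) * T₁ + (- 4ℚ * b) * T₂ + 4ℚ * t) T₃-value))) ⟩
      S + 2ℚ * (b - 2ℚ) * (D * q - A * A) + 4ℚ * b * q ∎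

    -- The defect in the Cauchy-Schwarz inequality over the neighbours of `x`.
    V : ℚ
    V = D * q - A * A

    4b-gap : ∀ r K → b * 4ℚ * gap f x r K ≡
      S + 2ℚ * (b - 2ℚ) * V + (4ℚ - 2ℚ * K) * b * q - 4ℚ * b * r * (A * A)
    4b-gap r K = begin
      b * 4ℚ * (Γ₂ f f x - (r * (A * A) + K * Γ f f x))
        ≡⟨ cong (λ t → b * 4ℚ * (Γ₂ f f x - (r * (A * A) + K * t))) (Γ-self f x) ⟩
      b * 4ℚ * (Γ₂ f f x - (r * (A * A) + K * (½ * q)))
        ≡⟨ solve 6 (λ b G r A K q → b :* con 4ℚ :* (G :- (r :* (A :* A) :+ K :* (con ½ :* q)))
             := b :* (con 4ℚ :* G) :- (con 4ℚ :* b :* r :* (A :* A) :+ con 2ℚ :* K :* b :* q))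
             refl b (Γ₂ f f x) r A K q ⟩
      b * (4ℚ * Γ₂ f f x) - (4ℚ * b * r * (A * A) + 2ℚ * K * b * q)
        ≡⟨ cong (λ t → t - (4ℚ * b * r * (A * A) + 2ℚ * K * b * q)) 4bΓ₂ ⟩
      S + 2ℚ * (b - 2ℚ) * V + 4ℚ * b * q - (4ℚ * b * r * (A * A) + 2ℚ * K * b * q)
        ≡⟨ solve 5 (λ u b q v K → u :+ con 4ℚ :* b :* q :- (v :+ con 2ℚ :* K :* b :* q)
             := u :+ (con 4ℚ :- con 2ℚ :* K) :* b :* q :- v) refl
             (S + 2ℚ * (b - 2ℚ) * V) b q (4ℚ * b * r * (A * A)) K ⟩
      S + 2ℚ * (b - 2ℚ) * V + (4ℚ - 2ℚ * K) * b * q - 4ℚ * b * r * (A * A) ∎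

    -- For this constant the remaining terms in `q` and in the square of `A` occur in the ratio of
    -- `V`, so they merge into a multiple of `V`.
    4b-gap-2-2Dr : ∀ r → b * 4ℚ * gap f x r (2ℚ - 2ℚ * D * r) ≡ S + (2ℚ * (b - 2ℚ) + 4ℚ * b * r) * V
    4b-gap-2-2Dr r = trans (4b-gap r (2ℚ - 2ℚ * D * r))
      (solve 6 (λ S b D q A r →
        S :+ con 2ℚ :* (b :- con 2ℚ) :* (D :* q :- A :* A)
          :+ (con 4ℚ :- con 2ℚ :* (con 2ℚ :- con 2ℚ :* D :* r)) :* b :* q :- con 4ℚ :* b :* r :* (A :* A)
        := S :+ (con 2ℚ :* (b :- con 2ℚ) :+ con 4ℚ :* b :* r) :* (D :* q :- A :* A)) refl S b D q A r)

    -- For β = 1 this constant cancels all terms in `q`. What remains changes sign at r = ½, which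
    -- is the threshold 2 for the dimension.
    4b-gap-2-D : b ≡ 1ℚ → ∀ r → b * 4ℚ * gap f x r (2ℚ - D) ≡ S + 4ℚ * (½ - r) * (A * A)
    4b-gap-2-D b≡1 r = trans (4b-gap r (2ℚ - D)) (trans
      (cong (λ b → S + 2ℚ * (b - 2ℚ) * V + (4ℚ - 2ℚ * (2ℚ - D)) * b * q - 4ℚ * b * r * (A * A)) b≡1)
      (solve 5 (λ S D q A r →
        S :+ con 2ℚ :* (con 1ℚ :- con 2ℚ) :* (D :* q :- A :* A)
          :+ (con 4ℚ :- con 2ℚ :* (con 2ℚ :- D)) :* con 1ℚ :* q :- con 4ℚ :* con 1ℚ :* r :* (A :* A)
        := S :+ con 4ℚ :* (con ½ :- r) :* (A :* A)) refl S D q A r))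

    S-nonNeg : 0ℚ ≤ S
    S-nonNeg = ∑-nonNeg (λ z → 0≤p*q (⟦⟧-nonNeg (¬? (x Fin.≟ z) ×-dec ¬? (x ∼? z)))
                                 (0≤p² (b * g z - 2ℚ * s z)))

    -- D * V is the sum of the squares (D g y - A)² over the neighbours y of x.
    V-nonNeg : .{{Positive D}} → 0ℚ ≤ V
    V-nonNeg = 0≤p*q⇒0≤q D (subst (0ℚ ≤_) D*V
      (∑-nonNeg (λ y → 0≤p*q (⟦⟧-nonNeg (x ∼? y)) (0≤p² (D * g y - A)))))
      where
      D*V : sum (λ y → e x y * ((D * g y - A) * (D * g y - A))) ≡ D * V
      D*V = begin
        sum (λ y → e x y * ((D * g y - A) * (D * g y - A)))
          ≡⟨ sum-cong-≗ (λ y → solve 4 (λ e g D A → e :* ((D :* g :- A) :* (D :* g :- A)) :=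
               (D :* D) :* (e :* (g :* g)) :+ (con (- 2ℚ) :* D :* A) :* (e :* g) :+ (A :* A) :* e) refl
               (e x y) (g y) D A) ⟩
        sum (λ y → (D * D) * (e x y * (g y * g y)) + (- 2ℚ * D * A) * (e x y * g y) + (A * A) * e x y)
          ≡⟨ ∑-lincomb {n} (D * D) (- 2ℚ * D * A) (A * A) _ _ _ ⟩
        (D * D) * q + (- 2ℚ * D * A) * A + (A * A) * sum (e x)
          ≡⟨ cong (λ t → (D * D) * q + (- 2ℚ * D * A) * A + (A * A) * t) (degree x) ⟩
        (D * D) * q + (- 2ℚ * D * A) * A + (A * A) * D
          ≡⟨ solve 3 (λ D q A → (D :* D) :* q :+ (con (- 2ℚ) :* D :* A) :* A :+ (A :* A) :* D
               := D :* (D :* q :- A :* A)) refl D q A ⟩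
        D * V ∎

  -- The values on the second sphere solve b * f z ≡ 2ℚ * s z, so that S vanishes; everything
  -- is scaled by b to avoid dividing by it.
  module Extremal (x : Fin n) (a : Fin n → ℚ) where
    t f : Fin n → ℚ
    t z = sum (λ y → e y z * (e x y * a y))
    f z = b * (e x z * a z) + 2ℚ * (w x z * t z)

    open At x f

    f-at-x : f x ≡ 0ℚ
    f-at-x = trans
      (cong₂ (λ u v → b * (u * a x) + 2ℚ * (v * t x)) (e-irrefl x) (w-irrefl x))
      (solve 3 (λ b a t → b :* (con 0ℚ :* a) :+ con 2ℚ :* (con 0ℚ :* t) := con 0ℚ) refl b (a x) (t x))

    g≡f : ∀ z → g z ≡ f z
    g≡f z = trans (cong (λ u → f z - u) f-at-x) (ℚ.+-identityʳ (f z))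

    e*f : ∀ z → p z ≡ b * (e x z * a z)
    e*f z = begin
      e x z * g z   ≡⟨ cong (λ u → e x z * u) (g≡f z) ⟩
      e x z * (b * (e x z * a z) + 2ℚ * (w x z * t z))
        ≡⟨ solve 5 (λ e b a w t → e :* (b :* (e :* a) :+ con 2ℚ :* (w :* t))
             := b :* ((e :* e) :* a) :+ con 2ℚ :* t :* (w :* e)) refl (e x z) b (a z) (w x z) (t z) ⟩
      b * ((e x z * e x z) * a z) + 2ℚ * t z * (w x z * e x z)
        ≡⟨ cong₂ (λ u v → b * (u * a z) + 2ℚ * t z * v) (⟦⟧-idem (x ∼? z)) (w*e x z) ⟩
      b * (e x z * a z) + 2ℚ * t z * 0ℚ
        ≡⟨ solve 2 (λ u t → u :+ con 2ℚ :* t :* con 0ℚ := u) refl (b * (e x z * a z)) (t z) ⟩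
      b * (e x z * a z) ∎

    A-value : A ≡ b * sum (λ y → e x y * a y)
    A-value = trans (sum-cong-≗ e*f) (∑-scale {n} b _)

    q-value : q ≡ b * b * sum (λ y → e x y * (a y * a y))
    q-value = trans (sym p²-sum) (trans
      (sum-cong-≗ (λ y → begin
        p y * p y                                    ≡⟨ cong₂ _*_ (e*f y) (e*f y) ⟩
        b * (e x y * a y) * (b * (e x y * a y))
          ≡⟨ solve 3 (λ b e a → b :* (e :* a) :* (b :* (e :* a)) := (b :* b) :* ((e :* e) :* (a :* a))) refl
              b (e x y) (a y) ⟩
        b * b * (e x y * e x y * (a y * a y))
          ≡⟨ cong (λ u → b * b * (u * (a y * a y))) (⟦⟧-idem (x ∼? y)) ⟩
        b * b * (e x y * (a y * a y)) ∎))
      (∑-scale {n} (b * b) _))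

    s-value : ∀ z → s z ≡ b * t z
    s-value z = trans
      (sum-cong-≗ (λ y → trans (cong (λ u → e y z * u) (e*f y))
        (solve 3 (λ e b u → e :* (b :* u) := b :* (e :* u)) refl (e y z) b (e x y * a y))))
      (∑-scale {n} b _)

    S≡0 : S ≡ 0ℚ
    S≡0 = ∑-zero (λ z → begin
      w x z * ((b * g z - 2ℚ * s z) * (b * g z - 2ℚ * s z))
        ≡⟨ cong₂ (λ u v → w x z * ((b * u - 2ℚ * v) * (b * u - 2ℚ * v))) (g≡f z) (s-value z) ⟩
      w x z * (R z * R z)
        ≡⟨ ℚ.*-assoc (w x z) (R z) (R z) ⟨
      w x z * R z * R z
        ≡⟨ cong (λ u → u * R z) (wR z) ⟩
      0ℚ * R z
        ≡⟨ ℚ.*-zeroˡ (R z) ⟩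
      0ℚ ∎)
      where
      R : Fin n → ℚ
      R z = b * f z - 2ℚ * (b * t z)
      wR : ∀ z → w x z * R z ≡ 0ℚ
      -- On the second sphere `e x z` is 0 and `w x z` is 1, and there the two parts of `R z`
      -- cancel; elsewhere the factor `w x z` is 0.
      wR z = begin
        w x z * (b * (b * (e x z * a z) + 2ℚ * (w x z * t z)) - 2ℚ * (b * t z))
          ≡⟨ solve 5 (λ w b e a t → w :* (b :* (b :* (e :* a) :+ con 2ℚ :* (w :* t)) :- con 2ℚ :* (b :* t))
               := b :* b :* a :* (w :* e) :+ con 2ℚ :* b :* t :* (w :* w :- w)) refl
                   (w x z) b (e x z) (a z) (t z) ⟩
        b * b * a z * (w x z * e x z) + 2ℚ * b * t z * (w x z * w x z - w x z)
          ≡⟨ cong₂ (λ u v → b * b * a z * u + 2ℚ * b * t z * (v - w x z)) (w*e x z)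
               (⟦⟧-idem (¬? (x Fin.≟ z) ×-dec ¬? (x ∼? z))) ⟩
        b * b * a z * 0ℚ + 2ℚ * b * t z * (w x z - w x z)
          ≡⟨ solve 4 (λ w b a t → b :* b :* a :* con 0ℚ :+ con 2ℚ :* b :* t :* (w :- w) := con 0ℚ) refl
              (w x z) b (a z) (t z) ⟩
        0ℚ ∎

  -- Signs of the gap and the functions that attain equality.

  module Bounds {{D>0 : Positive D}} {{b>0 : Positive b}} where

    4b>0 : Positive (b * 4ℚ)
    4b>0 = ℚ.pos*pos⇒pos b 4ℚ

    0≤b : 0ℚ ≤ b
    0≤b = ℚ.<⇒≤ (ℚ.positive⁻¹ b)

    module _ (x : Fin n) (f : Fin n → ℚ) where
      open At x f

      gap-2-2Dr-nonNeg : ∀ {r} → 2ℚ ≤ b → 0ℚ ≤ r → 0ℚ ≤ gap f x r (2ℚ - 2ℚ * D * r)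
      gap-2-2Dr-nonNeg {r} 2≤b 0≤r = 0≤p*q⇒0≤q (b * 4ℚ) {{4b>0}}
        (subst (0ℚ ≤_) (sym (4b-gap-2-2Dr r))
          (ℚ.+-mono-≤ S-nonNeg (0≤p*q
            (ℚ.+-mono-≤ (0≤p*q (ι-nonNeg 2) (p≤q⇒0≤q-p 2≤b)) (0≤p*q (0≤p*q (ι-nonNeg 4) 0≤b) 0≤r))
            V-nonNeg)))

      gap-2-D-nonNeg : ∀ {r} → b ≡ 1ℚ → r ≤ ½ → 0ℚ ≤ gap f x r (2ℚ - D)
      gap-2-D-nonNeg {r} b≡1 r≤½ = 0≤p*q⇒0≤q (b * 4ℚ) {{4b>0}}
        (subst (0ℚ ≤_) (sym (4b-gap-2-D b≡1 r))
          (ℚ.+-mono-≤ S-nonNeg (0≤p*q (0≤p*q (ι-nonNeg 4) (p≤q⇒0≤q-p r≤½)) (0≤p² A))))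

      -- For β = 1 the coefficient of `V` is 4(r - ½). A dimension at most 2 bounds the terms of its
      -- reciprocal below by ½ only up to some `η`, and the resulting deficit, a multiple of
      -- `η * V`, is paid for by `ε`.
      gap-2-2Dr-approx : ∀ {r η ε} → b ≡ 1ℚ → ½ - η ≤ r → η * V ≤ ε →
        0ℚ ≤ gap f x r (2ℚ - 2ℚ * D * r) + ε
      gap-2-2Dr-approx {r} {η} {ε} b≡1 ½-η≤r ηV≤ε = 0≤p*q⇒0≤q (b * 4ℚ) {{4b>0}}
        (subst (0ℚ ≤_) (sym identity)
          (ℚ.+-mono-≤ (ℚ.+-mono-≤ S-nonNeg
            (0≤p*q (0≤p*q (ι-nonNeg 4) (p≤q⇒0≤q-p ½-η≤r)) V-nonNeg))
            (0≤p*q (ι-nonNeg 4) (p≤q⇒0≤q-p ηV≤ε))))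
        where
        identity : b * 4ℚ * (gap f x r (2ℚ - 2ℚ * D * r) + ε) ≡
          S + 4ℚ * (r - (½ - η)) * V + 4ℚ * (ε - η * V)
        identity = begin
          b * 4ℚ * (gap f x r (2ℚ - 2ℚ * D * r) + ε)
            ≡⟨ ℚ.*-distribˡ-+ (b * 4ℚ) (gap f x r (2ℚ - 2ℚ * D * r)) ε ⟩
          b * 4ℚ * gap f x r (2ℚ - 2ℚ * D * r) + b * 4ℚ * ε
            ≡⟨ cong (λ t → t + b * 4ℚ * ε) (4b-gap-2-2Dr r) ⟩
          S + (2ℚ * (b - 2ℚ) + 4ℚ * b * r) * V + b * 4ℚ * ε
            ≡⟨ cong (λ b → S + (2ℚ * (b - 2ℚ) + 4ℚ * b * r) * V + b * 4ℚ * ε) b≡1 ⟩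
          S + (2ℚ * (1ℚ - 2ℚ) + 4ℚ * 1ℚ * r) * V + 1ℚ * 4ℚ * ε
            ≡⟨ solve 5 (λ S r V ε η →
                 S :+ (con 2ℚ :* (con 1ℚ :- con 2ℚ) :+ con 4ℚ :* con 1ℚ :* r) :* V :+ con 1ℚ :* con 4ℚ :* ε
                 := S :+ con 4ℚ :* (r :- (con ½ :- η)) :* V :+ con 4ℚ :* (ε :- η :* V)) refl S r V ε η ⟩
          S + 4ℚ * (r - (½ - η)) * V + 4ℚ * (ε - η * V) ∎

      -- Dropping the square of `A` compares `V` with Γ, which as the term of a real number is
      -- eventually bounded; this controls `V` at all large indices at once.
      V≤2DΓ : V ≤ 2ℚ * D * Γ f f x
      V≤2DΓ = subst₂ _≤_ (ℚ.+-identityʳ V)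
        (trans (solve 3 (λ D q A → D :* q :- A :* A :+ A :* A := con 2ℚ :* D :* (con ½ :* q)) refl D q A)
               (cong (2ℚ * D *_) (sym (Γ-self f x))))
        (ℚ.+-monoʳ-≤ V (0≤p² A))

    module _ (x : Fin n) (a : Fin n → ℚ) where
      open Extremal x a
      open At x f

      -- Strict positivity permits cancelling Γ when `f` tests whether a constant is the largest. On
      -- the first sphere `f` is `b` times `a`, hence the factor `b * b`.
      Γ-positive : Positive (sum (λ y → e x y * (a y * a y))) → Positive (Γ f f x)
      Γ-positive Σ>0 = subst Positive (sym (trans (Γ-self f x) (cong (½ *_) q-value)))
        (ℚ.pos*pos⇒pos ½ (b * b * sum (λ y → e x y * (a y * a y)))
          {{ℚ.pos*pos⇒pos (b * b) {{ℚ.pos*pos⇒pos b b}} _ {{Σ>0}}}})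

      gap-2-2Dr-extremal : V ≡ 0ℚ → ∀ r → gap f x r (2ℚ - 2ℚ * D * r) ≤ 0ℚ
      gap-2-2Dr-extremal V≡0 r = p*q≡0⇒q≤0 (b * 4ℚ) {{4b>0}} (begin
        b * 4ℚ * gap f x r (2ℚ - 2ℚ * D * r)  ≡⟨ 4b-gap-2-2Dr r ⟩
        S + (2ℚ * (b - 2ℚ) + 4ℚ * b * r) * V  ≡⟨ cong₂ (λ u v → u + (2ℚ * (b - 2ℚ) + 4ℚ * b * r) * v) S≡0 V≡0 ⟩
        0ℚ + (2ℚ * (b - 2ℚ) + 4ℚ * b * r) * 0ℚ
          ≡⟨ solve 1 (λ c → con 0ℚ :+ c :* con 0ℚ := con 0ℚ) refl (2ℚ * (b - 2ℚ) + 4ℚ * b * r) ⟩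
        0ℚ ∎)

      gap-2-D-extremal : b ≡ 1ℚ → A ≡ 0ℚ → ∀ r → gap f x r (2ℚ - D) ≤ 0ℚ
      gap-2-D-extremal b≡1 A≡0 r = p*q≡0⇒q≤0 (b * 4ℚ) {{4b>0}} (begin
        b * 4ℚ * gap f x r (2ℚ - D)   ≡⟨ 4b-gap-2-D b≡1 r ⟩
        S + 4ℚ * (½ - r) * (A * A)    ≡⟨ cong₂ (λ u v → u + 4ℚ * (½ - r) * (v * v)) S≡0 A≡0 ⟩
        0ℚ + 4ℚ * (½ - r) * (0ℚ * 0ℚ)
          ≡⟨ solve 1 (λ r → con 0ℚ :+ con 4ℚ :* (con ½ :- r) :* (con 0ℚ :* con 0ℚ) := con 0ℚ) refl r ⟩
        0ℚ ∎)

    module _ (x : Fin n) where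
      open Extremal x (λ _ → 1ℚ)
      open At x f

      ∑e*1 : sum (λ y → e x y * 1ℚ) ≡ D
      ∑e*1 = trans (sum-cong-≗ (λ y → ℚ.*-identityʳ (e x y))) (degree x)

      -- A function constant on the neighbours of `x` gives equality in Cauchy-Schwarz, so both `S`
      -- and `V` vanish.
      constant-extremal : ∃[ f ] Positive (Γ f f x) × (∀ r → gap f x r (2ℚ - 2ℚ * D * r) ≤ 0ℚ)
      constant-extremal = f
        , Γ-positive x (λ _ → 1ℚ) (subst Positive (sym ∑e*1) D>0)
        , gap-2-2Dr-extremal x (λ _ → 1ℚ) (begin
            D * q - A * A
              ≡⟨ cong₂ (λ u v → D * u - v * v) (trans q-value (cong (b * b *_) ∑e*1))
                  (trans A-value (cong (b *_) ∑e*1)) ⟩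
            D * (b * b * D) - b * D * (b * D)
              ≡⟨ solve 2 (λ D b → D :* (b :* b :* D) :- b :* D :* (b :* D) := con 0ℚ) refl D b ⟩
            0ℚ ∎)

    module _ {x y z : Fin n} (x∼y : x ∼ y) (x∼z : x ∼ z) (y≢z : y ≢ z) where
      a : Fin n → ℚ
      a v = δ y v - δ z v

      open Extremal x a
      open At x f

      e≡1 : ∀ {v} → x ∼ v → e x v ≡ 1ℚ
      e≡1 {v} x∼v with x ∼? v
      ... | yes _  = refl
      ... | no x≁v = ⊥-elim (x≁v x∼v)

      δδ≡0 : ∀ v → δ y v * δ z v ≡ 0ℚ
      δδ≡0 v with y Fin.≟ v | z Fin.≟ v
      ... | yes refl | yes refl = ⊥-elim (y≢z refl)
      ... | yes _    | no _     = refl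
      ... | no _     | yes _    = refl
      ... | no _     | no _     = refl

      ∑ea : sum (λ v → e x v * a v) ≡ 0ℚ
      ∑ea = begin
        sum (λ v → e x v * a v)
          ≡⟨ sum-cong-≗ (λ v → solve 3 (λ e s t → e :* (s :- t) :=
               con 1ℚ :* (s :* e) :+ con (- 1ℚ) :* (t :* e) :+ con 0ℚ :* e) refl (e x v) (δ y v) (δ z v)) ⟩
        sum (λ v → 1ℚ * (δ y v * e x v) + (- 1ℚ) * (δ z v * e x v) + 0ℚ * e x v)
          ≡⟨ ∑-lincomb {n} 1ℚ (- 1ℚ) 0ℚ _ _ _ ⟩
        1ℚ * sum (λ v → δ y v * e x v) + (- 1ℚ) * sum (λ v → δ z v * e x v) + 0ℚ * sum (e x)
          ≡⟨ cong₂ (λ s t → 1ℚ * s + (- 1ℚ) * t + 0ℚ * sum (e x))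
               (trans (∑-δ y (e x)) (e≡1 x∼y)) (trans (∑-δ z (e x)) (e≡1 x∼z)) ⟩
        1ℚ * 1ℚ + (- 1ℚ) * 1ℚ + 0ℚ * sum (e x)
          ≡⟨ solve 1 (λ t → con 1ℚ :* con 1ℚ :+ con (- 1ℚ) :* con 1ℚ :+ con 0ℚ :* t := con 0ℚ) refl
              (sum (e x)) ⟩
        0ℚ ∎

      ∑eaa : sum (λ v → e x v * (a v * a v)) ≡ 2ℚ
      ∑eaa = begin
        sum (λ v → e x v * (a v * a v))
          ≡⟨ sum-cong-≗ (λ v → begin
               e x v * (a v * a v)
                 ≡⟨ solve 3 (λ e s t → e :* ((s :- t) :* (s :- t)) :=
                      con 1ℚ :* ((s :* s) :* e) :+ con 1ℚ :* ((t :* t) :* e) :+ con (- 2ℚ) :* e :* (s :* t))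
                      refl (e x v) (δ y v) (δ z v) ⟩
               1ℚ * ((δ y v * δ y v) * e x v) + 1ℚ * ((δ z v * δ z v) * e x v) + (- 2ℚ) * e x v * (δ y v * δ z v)
                 ≡⟨ cong₂ (λ s t → 1ℚ * (s * e x v) + 1ℚ * (t * e x v) + (- 2ℚ) * e x v * (δ y v * δ z v))
                      (⟦⟧-idem (y Fin.≟ v)) (⟦⟧-idem (z Fin.≟ v)) ⟩
               1ℚ * (δ y v * e x v) + 1ℚ * (δ z v * e x v) + (- 2ℚ) * e x v * (δ y v * δ z v)
                 ≡⟨ cong (λ t → 1ℚ * (δ y v * e x v) + 1ℚ * (δ z v * e x v) + (- 2ℚ) * e x v * t) (δδ≡0 v) ⟩
               1ℚ * (δ y v * e x v) + 1ℚ * (δ z v * e x v) + (- 2ℚ) * e x v * 0ℚ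
                 ≡⟨ solve 2 (λ u e → u :+ con (- 2ℚ) :* e :* con 0ℚ := u :+ con 0ℚ :* e) refl
                      (1ℚ * (δ y v * e x v) + 1ℚ * (δ z v * e x v)) (e x v) ⟩
               1ℚ * (δ y v * e x v) + 1ℚ * (δ z v * e x v) + 0ℚ * e x v ∎) ⟩
        sum (λ v → 1ℚ * (δ y v * e x v) + 1ℚ * (δ z v * e x v) + 0ℚ * e x v)
          ≡⟨ ∑-lincomb {n} 1ℚ 1ℚ 0ℚ _ _ _ ⟩
        1ℚ * sum (λ v → δ y v * e x v) + 1ℚ * sum (λ v → δ z v * e x v) + 0ℚ * sum (e x)
          ≡⟨ cong₂ (λ s t → 1ℚ * s + 1ℚ * t + 0ℚ * sum (e x))
               (trans (∑-δ y (e x)) (e≡1 x∼y)) (trans (∑-δ z (e x)) (e≡1 x∼z)) ⟩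
        1ℚ * 1ℚ + 1ℚ * 1ℚ + 0ℚ * sum (e x)
          ≡⟨ solve 1 (λ t → con 1ℚ :* con 1ℚ :+ con 1ℚ :* con 1ℚ :+ con 0ℚ :* t := con 2ℚ) refl (sum (e x)) ⟩
        2ℚ ∎

      -- Opposite values at two neighbours cancel in `A`, the only remaining quantity through which
      -- `r` enters the gap.
      difference-extremal : b ≡ 1ℚ → ∃[ f ] Positive (Γ f f x) × (∀ r → gap f x r (2ℚ - D) ≤ 0ℚ)
      difference-extremal b≡1 = f
        , Γ-positive x a (subst Positive (sym ∑eaa) _)
        , gap-2-D-extremal x a b≡1 (trans A-value (trans (cong (b *_) ∑ea) (ℚ.*-zeroʳ b)))

-- Passage from real-valued to rational-valued functions, index by index.

module Pointwise {n : ℕ} (G : SimpleGraph n) where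
  open import Data.Rational.Base hiding (ℚ; 0ℚ; 1ℚ; ½)
  open SimpleGraph G
  open Discrete (adjacency G)

  at : ℕ → (Fin n → ℝ) → Fin n → ℚ
  at k f y = seq (f y) k

  seq-foldr : ∀ k (h : Fin n → ℝ) xs →
    seq (List.foldr Defs._+_ 0ℝ (List.map h xs)) k ≡ List.foldr _+_ 0ℚ (List.map (at k h) xs)
  seq-foldr k h []       = refl
  seq-foldr k h (x ∷ xs) = cong (λ t → seq (h x) k + t) (seq-foldr k h xs)

  seq-Δ : ∀ k f x → seq (Defs.Δ G f x) k ≡ Δ (at k f) x
  seq-Δ k f x = trans (seq-foldr k (λ y → f y Defs.- f x) (neighbours G x))
    (foldr-filter-allFin (x ∼?_) (λ y → seq (f y) k - seq (f x) k))

  Δ-cong : ∀ {f g : Fin n → ℚ} → (∀ y → f y ≡ g y) → ∀ x → Δ f x ≡ Δ g x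
  Δ-cong f≡g x = sum-cong-≗ (λ y → cong₂ (λ u v → adjacency G x y * (u - v)) (f≡g y) (f≡g x))

  Γ-cong : ∀ {f f′ g g′ : Fin n → ℚ} → (∀ y → f y ≡ f′ y) → (∀ y → g y ≡ g′ y) → ∀ x → Γ f g x ≡ Γ f′ g′ x
  Γ-cong {f} {f′} {g} {g′} f≡ g≡ x = cong (½ *_) (cong₂ _-_
    (cong₂ _-_ (Δ-cong (λ y → cong₂ _*_ (f≡ y) (g≡ y)) x) (cong₂ _*_ (f≡ x) (Δ-cong g≡ x)))
    (cong₂ _*_ (g≡ x) (Δ-cong f≡ x)))

  seq-Γ : ∀ k f g x → seq (Defs.Γ G f g x) k ≡ Γ (at k f) (at k g) x
  seq-Γ k f g x = cong (½ *_) (cong₂ _-_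
    (cong₂ _-_ (seq-Δ k (λ y → f y Defs.* g y) x) (cong (seq (f x) k *_) (seq-Δ k g x)))
    (cong (seq (g x) k *_) (seq-Δ k f x)))

  seq-Γ₂ : ∀ k f g x → seq (Defs.Γ₂ G f g x) k ≡ Γ₂ (at k f) (at k g) x
  seq-Γ₂ k f g x = cong (½ *_) (cong₂ _-_
    (cong₂ _-_
      (trans (seq-Δ k (Defs.Γ G f g) x) (Δ-cong (seq-Γ k f g) x))
      (trans (seq-Γ k f (Defs.Δ G g) x) (Γ-cong {f = at k f} (λ _ → refl) (seq-Δ k g) x)))
    (trans (seq-Γ k (Defs.Δ G f) g x) (Γ-cong {g = at k g} (seq-Δ k f) (λ _ → refl) x)))

  module _ (x : Fin n) (𝒩 : Dimension) (K : ℝ) {κ : ℕ → ℚ} (K≡κ : ∀ k → seq K k ≡ κ k) where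
    r : ℕ → ℚ
    r = seq (recip 𝒩)

    lhs : ∀ k f K → seq (recip 𝒩 Defs.* (Defs.Δ G f x Defs.* Defs.Δ G f x) Defs.+ K Defs.* Defs.Γ G f f x) k
      ≡ r k * (Δ (at k f) x * Δ (at k f) x) + seq K k * Γ (at k f) (at k f) x
    lhs k f K = cong₂ _+_
      (cong (λ t → r k * t) (cong₂ _*_ (seq-Δ k f x) (seq-Δ k f x)))
      (cong (λ t → seq K k * t) (seq-Γ k f f x))

    -- At a fixed index both sides are rational expressions in the terms of `f`. The order on reals
    -- compares them from some index on and up to `ε`, and that index may depend on `f` and `ε`.
    curvatureDimension :
      (∀ f ε → 0ℚ < ε → ∃[ M ] ∀ k → M ℕ.≤ k → 0ℚ ≤ gap (at k f) x (r k) (κ k) + ε) →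
      Defs.CurvatureDimension G x 𝒩 K
    curvatureDimension h f ε 0<ε =
      let M , bound = h f ε 0<ε
      in M , λ k M≤k → subst₂ (λ u v → u ≤ v + ε) (sym (lhs k f K)) (sym (seq-Γ₂ k f f x))
           (rearrange (r k * (Δ (at k f) x * Δ (at k f) x) + seq K k * Γ (at k f) (at k f) x)
             (Γ₂ (at k f) (at k f) x)
             (subst (λ t → 0ℚ ≤ gap (at k f) x (r k) t + ε) (sym (K≡κ k)) (bound k M≤k)))
      where
      rearrange : ∀ l m → 0ℚ ≤ m - l + ε → l ≤ m + ε
      rearrange l m h = subst₂ _≤_ (ℚ.+-identityʳ l)
        (solve 3 (λ l m ε → l :+ (m :- l :+ ε) := m :+ ε) refl l m ε)
        (ℚ.+-monoʳ-≤ l h)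

    -- A competitor `K′` is tested on the constant sequences of `f` with tolerance `ε * Γ f f x`.
    -- Since the gap at `K` is at most 0, the excess of `K′` over `K`, times Γ, is at most that
    -- tolerance, and the positive Γ cancels.
    largest : (f : Fin n → ℚ) → Positive (Γ f f x) → (∀ k → gap f x (r k) (κ k) ≤ 0ℚ) →
      ∀ K′ → Defs.CurvatureDimension G x 𝒩 K′ → K′ Defs.≤ K
    largest f Γ>0 gap≤0 K′ cd ε 0<ε =
      let M , bound = cd (fromℚ ∘ f) (ε * Γ f f x) (ℚ.positive⁻¹ (ε * Γ f f x)
                        {{ℚ.pos*pos⇒pos ε {{positive 0<ε}} (Γ f f x) {{Γ>0}}}})
      in M , λ k M≤k → ℚ.*-cancelʳ-≤-pos (Γ f f x) {{Γ>0}}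
           (rearrange k {Γ₂ f f x} {r k * (Δ f x * Δ f x)} (subst₂ (λ u v → u ≤ v + ε * Γ f f x) (lhs k (fromℚ ∘ f) K′)
             (seq-Γ₂ k (fromℚ ∘ f) (fromℚ ∘ f) x) (bound k M≤k))
             (subst (λ t → gap f x (r k) t ≤ 0ℚ) (sym (K≡κ k)) (gap≤0 k)))
      where
      rearrange : ∀ k {m l} → l + seq K′ k * Γ f f x ≤ m + ε * Γ f f x →
        m - (l + seq K k * Γ f f x) ≤ 0ℚ → seq K′ k * Γ f f x ≤ (seq K k + ε) * Γ f f x
      rearrange k {m} {l} h h′ = begin
        seq K′ k * Γ f f x
          ≡⟨ solve 2 (λ u l → u := (l :+ u) :- l) refl (seq K′ k * Γ f f x) l ⟩
        (l + seq K′ k * Γ f f x) - l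
          ≤⟨ ℚ.+-monoˡ-≤ (- l) h ⟩
        (m + ε * Γ f f x) - l
          ≡⟨ solve 5 (λ m ε Γ l K → (m :+ ε :* Γ) :- l := (m :- (l :+ K :* Γ)) :+ (K :+ ε) :* Γ) refl
              m ε (Γ f f x) l (seq K k) ⟩
        (m - (l + seq K k * Γ f f x)) + (seq K k + ε) * Γ f f x
          ≤⟨ ℚ.+-monoˡ-≤ ((seq K k + ε) * Γ f f x) h′ ⟩
        0ℚ + (seq K k + ε) * Γ f f x
          ≡⟨ ℚ.+-identityˡ _ ⟩
        (seq K k + ε) * Γ f f x ∎
        where open ℚ.≤-Reasoning

-- The reciprocal of the dimension on either side of the threshold 2.

module Reciprocal where
  open import Data.Rational.Base hiding (ℚ; 0ℚ; 1ℚ; ½)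

  -- The index j differs from k because `inverse` drops an initial segment of the sequence of N.
  inverse-spec : ∀ N (0<N : 0ℝ Defs.< N) k →
    0ℚ < seq (inverse N 0<N) k × ∃[ j ] k ℕ.≤ j × seq (inverse N 0<N) k * seq N j ≡ 1ℚ
  inverse-spec N (e , 0<e , M , e≤N) k =
      ℚ.positive⁻¹ ((1/ u) {{u≢0}}) {{ℚ.1/pos⇒pos u {{u>0}}}}
    , M ℕ.+ k , ℕ.m≤n+m k M , ℚ.*-inverseˡ u {{u≢0}}
    where
    u : ℚ
    u = seq N (M ℕ.+ k)
    u>0 : Positive u
    u>0 = positive (ℚ.<-≤-trans 0<e (ℚ.≤-trans (ℚ.≤-reflexive (sym (ℚ.+-identityˡ e)))
            (e≤N (M ℕ.+ k) (ℕ.m≤m+n M k))))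
    u≢0 : NonZero u
    u≢0 = ℚ.pos⇒nonZero u {{u>0}}

  recip-nonNeg : ∀ 𝒩 k → 0ℚ ≤ seq (recip 𝒩) k
  recip-nonNeg (finite N 0<N) k = ℚ.<⇒≤ (proj₁ (inverse-spec N 0<N k))
  recip-nonNeg ∞ k = ℚ.≤-refl

  -- Strict inequality of reals keeps the terms of `N` above 2 from some index on, so the bound
  -- holds there without an error term. At `∞` the reciprocal is 0.
  2<⇒recip≤½ : ∀ 𝒩 → Defs.fromℕ 2 Defs.<ᴰ 𝒩 → ∃[ M ] ∀ k → M ℕ.≤ k → seq (recip 𝒩) k ≤ ½
  2<⇒recip≤½ ∞ _ = 0 , λ _ _ → ℚ.nonNegative⁻¹ ½
  2<⇒recip≤½ (finite N 0<N) (e , 0<e , M , 2+e≤N) = M , λ k M≤k →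
    let 0<r , j , k≤j , rN≡1 = inverse-spec N 0<N k
    in bound (ℚ.<⇒≤ 0<r) rN≡1 (2+e≤N j (ℕ.≤-trans M≤k k≤j))
    where
    open ℚ.≤-Reasoning
    bound : ∀ {r u} → 0ℚ ≤ r → r * u ≡ 1ℚ → 2ℚ + e ≤ u → r ≤ ½
    bound {r} {u} 0≤r ru≡1 2+e≤u = begin
      r             ≡⟨ solve 1 (λ r → r := con ½ :* (r :* con 2ℚ)) refl r ⟩
      ½ * (r * 2ℚ)  ≤⟨ ℚ.*-monoˡ-≤-nonNeg ½ (ℚ.*-monoˡ-≤-nonNeg r {{nonNegative 0≤r}}
                        (ℚ.≤-trans (ℚ.≤-trans (ℚ.≤-reflexive (sym (ℚ.+-identityʳ 2ℚ)))
                          (ℚ.+-monoʳ-≤ 2ℚ (ℚ.<⇒≤ 0<e))) 2+e≤u)) ⟩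
      ½ * (r * u)   ≡⟨ cong (½ *_) ru≡1 ⟩
      ½             ∎

  ≤2⇒½≤recip : ∀ 𝒩 → 𝒩 Defs.≤ᴰ Defs.fromℕ 2 → ∀ η → 0ℚ < η →
    ∃[ M ] ∀ k → M ℕ.≤ k → ½ - η ≤ seq (recip 𝒩) k
  ≤2⇒½≤recip (finite N 0<N) N≤2 η 0<η =
    -- The tolerance 4η is chosen because (½ - η)(2 + 4η) = 1 - 4η², which is at most 1.
    let M , bounded = N≤2 (4ℚ * η) (ℚ.positive⁻¹ (4ℚ * η) {{ℚ.pos*pos⇒pos 4ℚ η {{η>0}}}})
    in M , λ k M≤k →
      let 0<r , j , k≤j , rN≡1 = inverse-spec N 0<N k
      in bound (ℚ.<⇒≤ 0<r) rN≡1 (bounded j (ℕ.≤-trans M≤k k≤j))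
    where
    open ℚ.≤-Reasoning
    η>0 : Positive η
    η>0 = positive 0<η
    c>0 : Positive (2ℚ + 4ℚ * η)
    c>0 = ℚ.pos+pos⇒pos 2ℚ (4ℚ * η) {{ℚ.pos*pos⇒pos 4ℚ η {{η>0}}}}
    bound : ∀ {r u} → 0ℚ ≤ r → r * u ≡ 1ℚ → u ≤ 2ℚ + 4ℚ * η → ½ - η ≤ r
    bound {r} {u} 0≤r ru≡1 u≤ = ℚ.*-cancelʳ-≤-pos (2ℚ + 4ℚ * η) {{c>0}} (begin
      (½ - η) * (2ℚ + 4ℚ * η)
        ≡⟨ solve 1 (λ η → (con ½ :- η) :* (con 2ℚ :+ con 4ℚ :* η) := con 1ℚ :- con 4ℚ :* (η :* η)) refl η ⟩
      1ℚ - 4ℚ * (η * η)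
        ≤⟨ ℚ.+-monoʳ-≤ 1ℚ (ℚ.neg-antimono-≤ (0≤p*q (ι-nonNeg 4) (0≤p² η))) ⟩
      1ℚ - 0ℚ                ≡⟨ ru≡1 ⟨
      r * u                  ≤⟨ ℚ.*-monoˡ-≤-nonNeg r {{nonNegative 0≤r}} u≤ ⟩
      r * (2ℚ + 4ℚ * η)      ∎)

-- The value of the curvature function in the three cases.

module Curvature {n d α β : ℕ} (G : SimpleGraph n) (srg : StronglyRegular G d α β)
  (triangle-free : TriangleFree G) (2≤d : 2 ℕ.≤ d) (x : Fin n) (𝒩 : Dimension) where
  open import Data.Rational.Base hiding (ℚ; 0ℚ; 1ℚ; ½)
  open TriangleFreeSRG G srg triangle-free
  open Discrete e
  open Pointwise G hiding (r)
  open Reciprocal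

  instance
    D>0 : Positive D
    D>0 = ι-positive (ℕ.≤-trans (ℕ.n≤1+n 1) 2≤d)
    b>0 : Positive b
    b>0 = ι-positive (StronglyRegular.β≥1 srg)

  open Bounds

  r : ℕ → ℚ
  r = seq (recip 𝒩)

  module _ (K : ℝ) (K≡ : ∀ k → seq K k ≡ 2ℚ - 2ℚ * D * r k) where

    largest-2-2Dr : ∀ K′ → Defs.CurvatureDimension G x 𝒩 K′ → K′ Defs.≤ K
    largest-2-2Dr =
      let f , Γ>0 , gap≤0 = constant-extremal x
      in largest x 𝒩 K K≡ f Γ>0 (λ k → gap≤0 (r k))

    2≤β⇒curvature : 2 ℕ.≤ β → Defs.HasCurvature G x 𝒩 K
    2≤β⇒curvature 2≤β =
        curvatureDimension x 𝒩 K K≡ (λ f ε 0<ε → 0 , λ k _ →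
          ℚ.+-mono-≤ (gap-2-2Dr-nonNeg x (at k f) (ι-mono-≤ 2≤β) (recip-nonNeg 𝒩 k)) (ℚ.<⇒≤ 0<ε))
      , largest-2-2Dr

    ηV≤ε : ∀ f k {η B ε} → 0ℚ < η → ∣ seq (Defs.Γ G f f x) k ∣ ≤ B → η * (2ℚ * D * B) ≡ ε →
      η * At.V x (at k f) ≤ ε
    ηV≤ε f k {η} {B} {ε} 0<η ∣Γ∣≤B ηC≡ε = begin
      η * At.V x (at k f)                  ≤⟨ ℚ.*-monoˡ-≤-nonNeg η (V≤2DΓ x (at k f)) ⟩
      η * (2ℚ * D * Γ (at k f) (at k f) x)
        ≡⟨ cong (λ t → η * (2ℚ * D * t)) (seq-Γ k f f x) ⟨
      η * (2ℚ * D * seq (Defs.Γ G f f x) k)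
        ≤⟨ ℚ.*-monoˡ-≤-nonNeg η (ℚ.*-monoˡ-≤-nonNeg (2ℚ * D) (ℚ.≤-trans (p≤∣p∣ _) ∣Γ∣≤B)) ⟩
      η * (2ℚ * D * B)                     ≡⟨ ηC≡ε ⟩
      ε                                    ∎
      where
      open ℚ.≤-Reasoning
      instance
        η≥0 : NonNegative η
        η≥0 = nonNegative (ℚ.<⇒≤ 0<η)
        2D≥0 : NonNegative (2ℚ * D)
        2D≥0 = ℚ.pos⇒nonNeg (2ℚ * D) {{ℚ.pos*pos⇒pos 2ℚ D}}

    β≡1∧𝒩≤2⇒curvature : b ≡ 1ℚ → 𝒩 Defs.≤ᴰ Defs.fromℕ 2 → Defs.HasCurvature G x 𝒩 K
    β≡1∧𝒩≤2⇒curvature b≡1 𝒩≤2 = curvatureDimension x 𝒩 K K≡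
        (λ f ε 0<ε → bound f ε 0<ε (Defs.eventually-bounded (Defs.Γ G f f x)))
      , largest-2-2Dr
      where
      bound : ∀ f ε → 0ℚ < ε →
        ∃[ B ] Positive B × ∃[ M ] (∀ k → M ℕ.≤ k → ∣ seq (Defs.Γ G f f x) k ∣ ≤ B) →
        ∃[ M ] ∀ k → M ℕ.≤ k → 0ℚ ≤ gap (at k f) x (r k) (2ℚ - 2ℚ * D * r k) + ε
      bound f ε 0<ε (B , B>0 , M₁ , ∣Γ∣≤B) =
        -- As `B` bounds Γ at every index from `M₁` on, the single choice η = ε / (2DB) serves all
        -- of them.
        let η , 0<η , ηC≡ε = quotient ε 0<ε (2ℚ * D * B)
              (ℚ.pos*pos⇒pos (2ℚ * D) {{ℚ.pos*pos⇒pos 2ℚ D}} B {{B>0}})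
            M₂ , ½-η≤r = ≤2⇒½≤recip 𝒩 𝒩≤2 η 0<η
        in M₁ ℕ.⊔ M₂ , λ k M≤k → gap-2-2Dr-approx x (at k f) {η = η} b≡1
             (½-η≤r k (ℕ.m⊔n≤o⇒n≤o M₁ M₂ M≤k))
             (ηV≤ε f k 0<η (∣Γ∣≤B k (ℕ.m⊔n≤o⇒m≤o M₁ M₂ M≤k)) ηC≡ε)

  β≡1∧2<𝒩⇒curvature : b ≡ 1ℚ → Defs.fromℕ 2 Defs.<ᴰ 𝒩 →
    ∀ K → (∀ k → seq K k ≡ 2ℚ - D) → Defs.HasCurvature G x 𝒩 K
  β≡1∧2<𝒩⇒curvature b≡1 2<𝒩 K K≡ =
      curvatureDimension x 𝒩 K K≡ (λ f ε 0<ε →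
        let M , r≤½ = 2<⇒recip≤½ 𝒩 2<𝒩
        in M , λ k M≤k → ℚ.+-mono-≤ (gap-2-D-nonNeg x (at k f) b≡1 (r≤½ k M≤k)) (ℚ.<⇒≤ 0<ε))
    -- Here `2≤d` is essential: the test function lives on two distinct neighbours of `x`.
    , (let y , z , x∼y , x∼z , y≢z = two-neighbours G srg 2≤d x
           f , Γ>0 , gap≤0 = difference-extremal x∼y x∼z y≢z b≡1
       in largest x 𝒩 K K≡ f Γ>0 (λ k → gap≤0 (r k)))

open import Defs

corollary11p7 : ∀ {n d α β : ℕ} (G : SimpleGraph n) → StronglyRegular G d α β →
    (Girth G 4 → ∀ (x : Fin n) (𝒩 : Dimension) →
    HasCurvature G x 𝒩 (fromℕ 2 - fromℕ 2 * fromℕ d * recip 𝒩))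
    ×
    (Girth G 5 → ∀ (x : Fin n) (𝒩 : Dimension) →
    (𝒩 ≤ᴰ fromℕ 2 → HasCurvature G x 𝒩 (fromℕ 2 - fromℕ 2 * fromℕ d * recip 𝒩))
    ×
    (fromℕ 2 <ᴰ 𝒩 → HasCurvature G x 𝒩 (fromℕ 2 - fromℕ d)))
corollary11p7 {d = d} G srg =
    (λ girth x 𝒩 → Curvature.2≤β⇒curvature G srg
      (girth≥4⇒triangle-free G girth ℕ.≤-refl) (girth≥4⇒2≤d G srg girth ℕ.≤-refl) x 𝒩
      -- Arithmetic on reals computes term by term, so the terms of the constant are known by
      -- `refl`.
      (fromℕ 2 - fromℕ 2 * fromℕ d * recip 𝒩) (λ _ → refl)
      (girth4⇒2≤β G srg girth))
  , λ girth x 𝒩 →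
      (λ 𝒩≤2 → Curvature.β≡1∧𝒩≤2⇒curvature G srg
        (girth≥4⇒triangle-free G girth (ℕ.n≤1+n 4)) (girth≥4⇒2≤d G srg girth (ℕ.n≤1+n 4)) x 𝒩
        (fromℕ 2 - fromℕ 2 * fromℕ d * recip 𝒩) (λ _ → refl)
        (cong ι (girth5⇒β≡1 G srg girth)) 𝒩≤2)
    , (λ 2<𝒩 → Curvature.β≡1∧2<𝒩⇒curvature G srg
        (girth≥4⇒triangle-free G girth (ℕ.n≤1+n 4)) (girth≥4⇒2≤d G srg girth (ℕ.n≤1+n 4)) x 𝒩
        (cong ι (girth5⇒β≡1 G srg girth)) 2<𝒩
        (fromℕ 2 - fromℕ d) (λ _ → refl))
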